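{- Let $(X,\mathcal L)$ be a covering clutter with $X=[d]$ in which all lines have the same size; let $s:=\{x\in\mathbb{R}^d:\sum_{j\in L}x_j=1\text{ for all }L\in\mathcal L\}$, $\mathcal O:=\mathbb{R}^d_{\ge0}$, $P:=s\cap\mathcal O$, $\Gamma_{\mathcal L}$ the graph joining any two distinct collinear points, and $\mathcal H:=\{h_{jk}\cap s : jk\text{ an edge of }\Gamma_{\mathcal L},\ h_{jk}\not\supseteq s\}$ with $h_{jk}$ the hyperplane $x_j=x_k$. Assume a positive latin labelling exists. Let $L_a^\circ(t)$ be the number of latin labellings with positive entries and all line sums equal to $t$, and $L_a(t)$ the number of pairs consisting of a nonnegative integer labelling with all line sums $t$ and an acyclic orientation of $\Gamma_{\mathcal L}$ compatible with it and realizable in $P^\circ$. Then $$L_a^\circ(t)=\sum_{u\in\mathcal L(P^\circ,\mathcal H)}\mu(\hat0,u)\,E_{u\cap\mathcal O^\circ}(t),\qquad L_a(t)=\sum_{u\in\mathcal L(P^\circ,\mathcal H)}|\mu(\hat0,u)|\,E_{u\cap\mathcal O}(t),$$ where $\mu$ is the Möbius function of $\mathcal L(P^\circ,\mathcal H)$.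
   Context: A covering clutter is a finite set $X$ with a family of nonempty subsets (lines), none containing another, whose union is $X$. A latin labelling has distinct values at any two distinct collinear points; a positive latin labelling is one with positive integer values and all line sums equal to a common $t$. Acyclic/compatible/realizable orientations: no directed cycle; $x_j\ge x_i$ for each edge $i\to j$; some $x$ in the set has $x_j>x_i$ for each edge $i\to j$. $\mathcal O^\circ$ is the open positive orthant, $P^\circ$ the relative interior of $P$. $\mathcal L(P^\circ,\mathcal H):=\{P^\circ\cap\bigcap\mathcal S:\mathcal S\subseteq\mathcal H\}\setminus\{\emptyset\}$ ordered by reverse inclusion with bottom $\hat0=P^\circ$; $E_{Q\cap u}(t)$ is the number of integer points in $t(Q\cap\bar u)$, where $\bar u=\bigcap\mathcal S$ is the flat whose intersection with $P^\circ$ is $u$. Möbius function: $\mu(r,r)=1$, $\mu(r,s)=-\sum_{r\le w<s}\mu(r,w)$ for $r<s$.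
   Formalization: The points of s, P, P° and the flats, and the points realizing orientations, are taken in ℚ^d instead of ℝ^d; all these sets are defined by rational linear conditions. t is a positive integer. -}

module Defs where

open import Data.Nat as ℕ using (ℕ; zero; suc)
open import Data.Integer as ℤ using (ℤ)
open import Data.Rational as ℚ using (ℚ; 0ℚ; 1ℚ)
open import Data.Bool using (Bool; true; false; if_then_else_; _xor_)
open import Data.Fin using (Fin; zero; suc)
open import Data.Fin.Subset using (Subset; _∈_; _⊆_; Nonempty; ∣_∣)
open import Data.Vec using (Vec; lookup)
open import Data.List using (List; length; [])
open import Data.List.Relation.Unary.All using (All)
open import Data.List.Relation.Unary.Unique.Propositional using (Unique)
import Data.List.Membership.Propositional as LM
open import Data.Product using (Σ; ∃; ∃-syntax; _×_; _,_)
open import Relation.Nullary using (¬_)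
open import Relation.Binary.PropositionalEquality using (_≡_; _≢_)
open import Function.Bundles using (_⇔_)

sumℕ : ∀ {n} → (Fin n → ℕ) → ℕ
sumℕ {zero}  f = 0
sumℕ {suc n} f = f zero ℕ.+ sumℕ (λ i → f (suc i))

sumℤ : ∀ {n} → (Fin n → ℤ) → ℤ
sumℤ {zero}  f = ℤ.0ℤ
sumℤ {suc n} f = f zero ℤ.+ sumℤ (λ i → f (suc i))

sumℚ : ∀ {n} → (Fin n → ℚ) → ℚ
sumℚ {zero}  f = 0ℚ
sumℚ {suc n} f = f zero ℚ.+ sumℚ (λ i → f (suc i))

HasCount : {A : Set} → (A → Set) → ℕ → Set
HasCount {A} P N =
  Σ (List A) λ xs → Unique xs × (∀ a → (a LM.∈ xs) ⇔ P a) × length xs ≡ N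

record CoveringClutter (d n : ℕ) (L : Fin n → Subset d) : Set where
  field
    nonempty  : ∀ i → Nonempty (L i)
    antichain : ∀ i j → i ≢ j → ¬ (L i ⊆ L j)
    covering  : ∀ (x : Fin d) → ∃[ i ] (x ∈ L i)

Uniform : ∀ {d n} → (Fin n → Subset d) → Set
Uniform L = ∀ i j → ∣ L i ∣ ≡ ∣ L j ∣

module _ {d n : ℕ} (L : Fin n → Subset d) where

  Edge : Fin d → Fin d → Set
  Edge j k = j ≢ k × ∃[ i ] (j ∈ L i × k ∈ L i)

  lineSumℕ : Fin n → (Fin d → ℕ) → ℕ
  lineSumℕ i f = sumℕ (λ j → if lookup (L i) j then f j else 0)

  lineSumℚ : Fin n → (Fin d → ℚ) → ℚ
  lineSumℚ i x = sumℚ (λ j → if lookup (L i) j then x j else 0ℚ)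

  Latin : (Fin d → ℕ) → Set
  Latin f = ∀ j k → Edge j k → f j ≢ f k

  PosLatin : ℕ → Vec ℕ d → Set
  PosLatin t f = (∀ j → 0 ℕ.< lookup f j)
               × Latin (lookup f)
               × (∀ i → lineSumℕ i (lookup f) ≡ t)

  NonnegLabelling : ℕ → Vec ℕ d → Set
  NonnegLabelling t f = ∀ i → lineSumℕ i (lookup f) ≡ t

  Point : Set
  Point = Fin d → ℚ

  InS : Point → Set
  InS x = ∀ i → lineSumℚ i x ≡ 1ℚ

  InO : Point → Set
  InO x = ∀ j → 0ℚ ℚ.≤ x j

  InO° : Point → Set
  InO° x = ∀ j → 0ℚ ℚ.< x j

  InP : Point → Set
  InP x = InS x × InO x

  -- relative interior of a convex set C:
  -- x ∈ C and for every y ∈ C the segment from y through x extends beyond x in C.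
  RelInt : (Point → Set) → Point → Set
  RelInt C x = C x × (∀ y → C y → ∃[ ε ] (0ℚ ℚ.< ε × C (λ j → x j ℚ.+ ε ℚ.* (x j ℚ.- y j))))

  InP° : Point → Set
  InP° = RelInt InP

  -- edges jk of Γ_L with h_jk ⊉ s (these index the arrangement H)
  HEdge : Fin d × Fin d → Set
  HEdge (j , k) = Edge j k × ∃[ y ] (InS y × y j ≢ y k)

  OnFlats : List (Fin d × Fin d) → Point → Set
  OnFlats S x = All (λ { (j , k) → x j ≡ x k }) S

  Region : List (Fin d × Fin d) → Point → Set
  Region S x = InP° x × OnFlats S x

  Flat : List (Fin d × Fin d) → Point → Set
  Flat S x = InS x × OnFlats S x

  SameSet : (Point → Set) → (Point → Set) → Set
  SameSet A B = ∀ x → A x ⇔ B x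

  IntPt : (Point → Set) → List (Fin d × Fin d) → ℕ → Vec ℤ d → Set
  IntPt Q S t y = ∃[ x ] (Q x × Flat S x × (∀ j → ℚ._/_ (lookup y j) (suc 0) ≡ ℚ._/_ (ℤ.+ t) (suc 0) ℚ.* x j))

  Orientation : Set
  Orientation = Vec (Vec Bool d) d

  arrow : Orientation → Fin d → Fin d → Bool
  arrow o j k = lookup (lookup o j) k

  IsOrientation : Orientation → Set
  IsOrientation o = ∀ j k → (Edge j k → (arrow o j k xor arrow o k j) ≡ true)
                          × (¬ Edge j k → arrow o j k ≡ false)

  data Path (o : Orientation) : Fin d → Fin d → Set where
    step : ∀ {j k} → arrow o j k ≡ true → Path o j k
    _∷_  : ∀ {j k l} → arrow o j k ≡ true → Path o k l → Path o j l

  Acyclic : Orientation → Set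
  Acyclic o = ∀ j → ¬ Path o j j

  Compatible : Orientation → (Fin d → ℕ) → Set
  Compatible o f = ∀ j k → arrow o j k ≡ true → f j ℕ.≤ f k

  RealizableIn : (Point → Set) → Orientation → Set
  RealizableIn C o = ∃[ x ] (C x × (∀ j k → arrow o j k ≡ true → x j ℚ.< x k))

  LaPair : ℕ → Vec ℕ d × Orientation → Set
  LaPair t (f , o) = NonnegLabelling t f × IsOrientation o × Acyclic o
                   × Compatible o (lookup f) × RealizableIn InP° o

  -- An explicit presentation of the finite poset  L(P°, H)  (ordered by reverse
  -- inclusion): its m elements are u_a = P° ∩ ⋂ (rep a), listed without repetition,
  -- with the strict order decided by lt, and bottom element P°.

  record Presentation (m : ℕ) : Set where
    field
      rep       : Fin m → List (Fin d × Fin d)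
      repValid  : ∀ a → All HEdge (rep a)
      repNonempty : ∀ a → ∃[ x ] Region (rep a) x
      repDistinct : ∀ a b → SameSet (Region (rep a)) (Region (rep b)) → a ≡ b
      repCover  : ∀ S → All HEdge S → ∃[ x ] Region S x →
                  ∃[ a ] SameSet (Region S) (Region (rep a))
      lt        : Fin m → Fin m → Bool
      ltSpec    : ∀ a b → (lt a b ≡ true) ⇔
                  (a ≢ b × (∀ x → Region (rep b) x → Region (rep a) x))
      bot       : Fin m
      botSpec   : SameSet (Region (rep bot)) (Region [])

  IsMobiusFromBottom : ∀ {m} → Presentation m → (Fin m → ℤ) → Set
  IsMobiusFromBottom {m} Pr mu =
      mu (Presentation.bot Pr) ≡ ℤ.1ℤ
    × (∀ a → a ≢ Presentation.bot Pr →
         mu a ≡ ℤ.- sumℤ (λ b → if Presentation.lt Pr b a then mu b else ℤ.0ℤ))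

{-# OPTIONS --safe #-}
module Submission where

-- Since a positive latin labelling exists, P° consists of the positive points of s, and no
-- hyperplane of H contains s.  The regions of an open convex set cut by hyperplanes satisfy
-- deletion–restriction r(u, A ∪ h) = r(u, A) + r(u ∩ h, A), hence r(P°, A) is the sum of
-- (-1)^(|S| - codim ⋂S) over the S ⊆ A whose intersection meets P°.  The part of this sum with
-- ⋂S = u is nonnegative by the same recursion, and it is (-1)^(codim u) μ(0̂, u) by Whitney's
-- formula; so it is |μ(0̂, u)|.  A labelling of line sum t is t times a point x of P.  Nudging
-- x into P° shows that the orientations paired with it are the regions of P° cut by the
-- hyperplanes through x, so they number the sum of |μ(0̂, u)| over the flats ū containing x.
-- If x ∈ P°, the sum of μ(0̂, u) over these flats is 1 or 0 according as x is latin or not.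
-- All of this needs decidability of the realizability of finitely many sign patterns, which
-- may be assumed because equality of integers is stable under double negation.

open import Defs
open import Data.Nat as ℕ using (ℕ; zero; suc)
import Data.Nat.Properties as ℕ
open import Data.Integer as ℤ using (ℤ; 0ℤ; 1ℤ; -1ℤ)
import Data.Integer.Properties as ℤ
import Data.Integer.Solver as ℤ-Solver
open import Data.Rational as ℚ using (ℚ; 0ℚ; 1ℚ)
import Data.Rational.Properties as ℚ
import Data.Rational.Solver as ℚ-Solver
import Data.Rational.Unnormalised as ℚᵘ
import Data.Rational.Unnormalised.Properties as ℚᵘ
open import Data.Bool as Bool using (Bool; true; false; if_then_else_; _xor_)
open import Data.Empty using (⊥)
open import Data.Fin as Fin using (Fin; zero; suc)
import Data.Fin.Properties as Fin
open import Data.Fin.Induction using (spo-wellFounded)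
open import Data.Fin.Subset using (Subset) renaming (_∈_ to _∈ˢ_)
open import Data.Fin.Subset.Properties using () renaming (_∈?_ to _∈ˢ?_)
open import Data.List as List using (List; []; _∷_; _++_; map; filter; length; allFin; cartesianProduct)
import Data.List.Properties as List
import Data.List.Membership.DecPropositional as DecMembership
open import Data.List.Membership.Propositional using (_∈_)
open import Data.List.Membership.Propositional.Properties
  using (∈-filter⁺; ∈-filter⁻; ∈-cartesianProduct⁺; ∈-allFin; ∈-lookup)
open import Data.List.Relation.Binary.Permutation.Propositional as Perm using (_↭_)
import Data.List.Relation.Binary.Permutation.Propositional.Properties as Perm
open import Data.List.Relation.Binary.Subset.Propositional using (_⊆_)
open import Data.List.Relation.Unary.All as All using (All; []; _∷_; all?)
import Data.List.Relation.Unary.All.Properties as All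
open import Data.List.Relation.Unary.AllPairs using ([]; _∷_)
open import Data.List.Relation.Unary.Any using (here; there; index)
open import Data.List.Relation.Unary.Any.Properties using (lookup-index)
open import Data.List.Relation.Unary.Unique.Propositional using (Unique)
import Data.List.Relation.Unary.Unique.Propositional.Properties as Unique
open import Data.Product using (∃; ∃-syntax; _×_; _,_; proj₁; proj₂)
import Data.Product.Properties as Product
open import Data.Sum using (_⊎_; inj₁; inj₂)
open import Data.Vec as Vec using (Vec)
import Data.Vec.Properties as Vec
open import Function using (_∘_; id; const)
open import Function.Bundles using (_⇔_; Equivalence; mk⇔)
open import Induction.WellFounded using (Acc; acc)
open import Relation.Binary using (DecidableEquality; IsStrictPartialOrder; Tri; tri<; tri≈; tri>)
open import Relation.Binary.PropositionalEquality
open import Relation.Nullary using (¬_; Dec; yes; no; contradiction; ¬?; _×-dec_; does)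
open import Relation.Nullary.Decidable using (¬¬-excluded-middle; dec-false; dec-true; decidable-stable; from-yes; map′)
open import Relation.Unary using (Decidable)

open Equivalence using (to; from)

-- No rank function comes with the poset, so codimension enters only as a sign. When ⋂S is built one
-- hyperplane at a time, each new hyperplane either contains what is already there or lowers the
-- dimension by one, and the resulting product of signs must not depend on the order. This is where
-- the geometry is used, in `exchange`; everything else about flats needs only affine functionals
-- along lines over ℚ. Edges of Γ are listed in both directions, so each hyperplane occurs at least
-- twice, and different edges may also cut s in the same hyperplane. Hence sums over sublists of one
-- fixed list can stand for sums over sets of hyperplanes. The points of P counted by `LaPair` may
-- lie on the boundary of the orthant, where nothing about P° applies directly. `Flat-⊑` extends
-- inclusions of flats from P° to s, and `nudge` moves a boundary point into P° without losing the
-- signs it already has.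

module Rationals where

  -- Order estimates in ℚ and the embedding of ℤ

  open import Data.Rational using (_+_; _*_; _-_; -_; _<_; _≤_; ∣_∣; 1/_)
  open import Data.Rational.Properties
  open ℚ-Solver.+-*-Solver using (solve; _:+_; _:*_; :-_; _:-_; con; _:=_)

  abstract
    p<q⇒0<q-p : ∀ {p q} → p < q → 0ℚ < q - p
    p<q⇒0<q-p {p} {q} p<q = subst (_< q - p) (+-inverseʳ p) (+-monoˡ-< (- p) p<q)

    p-q+q≡p : ∀ p q → p - q + q ≡ p
    p-q+q≡p = solve 2 (λ p q → p :- q :+ q := p) refl

    0<q-p⇒p<q : ∀ {p q} → 0ℚ < q - p → p < q
    0<q-p⇒p<q {p} {q} h = subst₂ _<_ (+-identityˡ p) (p-q+q≡p q p) (+-monoˡ-< p h)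

    p-q<0⇒p<q : ∀ {p q} → p - q < 0ℚ → p < q
    p-q<0⇒p<q {p} {q} h = subst₂ _<_ (p-q+q≡p p q) (+-identityˡ q) (+-monoˡ-< q h)

    p<q⇒p-q<0 : ∀ {p q} → p < q → p - q < 0ℚ
    p<q⇒p-q<0 {p} {q} p<q = subst (p - q <_) (+-inverseʳ q) (+-monoˡ-< (- q) p<q)

    p≡q⇒q-p≡0 : ∀ {p q} → p ≡ q → q - p ≡ 0ℚ
    p≡q⇒q-p≡0 {p} refl = +-inverseʳ p

    q-p≡0⇒p≡q : ∀ {p q} → q - p ≡ 0ℚ → p ≡ q
    q-p≡0⇒p≡q {p} {q} h = trans (sym (+-identityˡ p)) (trans (cong (_+ p) (sym h)) (p-q+q≡p q p))

    *-pos : ∀ {p q} → 0ℚ < p → 0ℚ < q → 0ℚ < p * q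
    *-pos {p} {q} 0<p 0<q =
      positive⁻¹ (p * q) {{pos*pos⇒pos p {{ℚ.positive 0<p}} q {{ℚ.positive 0<q}}}}

    *-neg : ∀ {p q} → 0ℚ < p → q < 0ℚ → p * q < 0ℚ
    *-neg {p} {q} 0<p q<0 =
      negative⁻¹ (p * q) {{pos*neg⇒neg p {{ℚ.positive 0<p}} q {{ℚ.negative q<0}}}}

    *-nonNeg : ∀ {p q} → 0ℚ ≤ p → 0ℚ ≤ q → 0ℚ ≤ p * q
    *-nonNeg {p} {q} 0≤p 0≤q =
      nonNegative⁻¹ (p * q) {{nonNeg*nonNeg⇒nonNeg p {{ℚ.nonNegative 0≤p}} q {{ℚ.nonNegative 0≤q}}}}

    1/-pos : ∀ {p} → 0ℚ < p → ∃[ q ] (0ℚ < q × p * q ≡ 1ℚ)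
    1/-pos {p} 0<p = (1/ p) {{nz}} , positive⁻¹ _ {{1/pos⇒pos p {{ℚ.positive 0<p}}}} , *-inverseʳ p {{nz}}
      where
      nz : ℚ.NonZero p
      nz = pos⇒nonZero p {{ℚ.positive 0<p}}

    *-cancelˡ : ∀ {p q r} → 0ℚ < p → p * q ≡ p * r → q ≡ r
    *-cancelˡ {p} {q} {r} 0<p eq with i , _ , pi≡1 ← 1/-pos 0<p =
      trans (undo q) (trans (cong (i *_) eq) (sym (undo r)))
      where
      undo : ∀ x → x ≡ i * (p * x)
      undo x = trans (sym (*-identityˡ x)) (trans (cong (_* x) (sym pi≡1))
        (solve 3 (λ p i x → p :* i :* x := i :* (p :* x)) refl p i x))

    *-zero-cancelˡ : ∀ {p q} → 0ℚ < p → p * q ≡ 0ℚ → q ≡ 0ℚ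
    *-zero-cancelˡ {p} 0<p eq = *-cancelˡ 0<p (trans eq (sym (*-zeroʳ p)))

    p≤∣p∣ : ∀ p → p ≤ ∣ p ∣
    p≤∣p∣ p with ≤-total 0ℚ p
    ... | inj₁ 0≤p = ≤-reflexive (sym (0≤p⇒∣p∣≡p 0≤p))
    ... | inj₂ p≤0 = ≤-trans p≤0 (0≤∣p∣ p)

    0<1+∣p∣ : ∀ p → 0ℚ < 1ℚ + ∣ p ∣
    0<1+∣p∣ p = <-≤-trans (positive⁻¹ 1ℚ) (subst (_≤ 1ℚ + ∣ p ∣) (+-identityʳ 1ℚ) (+-monoʳ-≤ 1ℚ (0≤∣p∣ p)))

    -- Take ε = a/(1+|b|); then |s b| ≤ ε|b| = a - ε < a.
    small-perturbation : ∀ {a} b → 0ℚ < a → ∃[ ε ] (0ℚ < ε × (∀ s → ∣ s ∣ ≤ ε → 0ℚ < a + s * b))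
    small-perturbation {a} b 0<a with i , 0<i , inv ← 1/-pos (0<1+∣p∣ b) = ε , 0<ε , bound
      where
      ε : ℚ
      ε = a * i
      0<ε : 0ℚ < ε
      0<ε = *-pos 0<a 0<i
      a≡ : ε + ε * ∣ b ∣ ≡ a
      a≡ = trans (solve 3 (λ a i b → a :* i :+ a :* i :* b := a :* ((con 1ℚ :+ b) :* i)) refl a i ∣ b ∣)
                 (trans (cong (a *_) inv) (*-identityʳ a))
      bound : ∀ s → ∣ s ∣ ≤ ε → 0ℚ < a + s * b
      bound s s≤ε = subst (0ℚ <_) (solve 2 (λ a t → a :- (:- t) := a :+ t) refl a (s * b)) (p<q⇒0<q-p (begin-strict
        - (s * b)       ≤⟨ p≤∣p∣ (- (s * b)) ⟩
        ∣ - (s * b) ∣   ≡⟨ ∣-p∣≡∣p∣ (s * b) ⟩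
        ∣ s * b ∣       ≡⟨ ∣p*q∣≡∣p∣*∣q∣ s b ⟩
        ∣ s ∣ * ∣ b ∣   ≤⟨ *-monoʳ-≤-nonNeg ∣ b ∣ {{∣-∣-nonNeg b}} s≤ε ⟩
        ε * ∣ b ∣       ≡⟨ sym (+-identityˡ _) ⟩
        0ℚ + ε * ∣ b ∣  <⟨ +-monoˡ-< (ε * ∣ b ∣) 0<ε ⟩
        ε + ε * ∣ b ∣   ≡⟨ a≡ ⟩
        a               ∎))
        where open ≤-Reasoning

    zero-crossing : ∀ {a b} → a < 0ℚ → 0ℚ < b → ∃[ s ] (0ℚ < s × s < 1ℚ × a + s * (b - a) ≡ 0ℚ)
    zero-crossing {a} {b} a<0 0<b with i , 0<i , inv ← 1/-pos (p<q⇒0<q-p (<-trans a<0 0<b)) =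
      -- The affine function with values a at 0 and b at 1 vanishes at s = -a/(b-a), and 1 - s =
      -- b/(b-a) is positive.
      - a * i , *-pos (neg-antimono-< a<0) 0<i ,
      0<q-p⇒p<q (subst (0ℚ <_) one (*-pos 0<b 0<i)) ,
      trans (solve 3 (λ a b i → a :+ :- a :* i :* (b :- a) := a :- a :* ((b :- a) :* i)) refl a b i)
        (trans (cong (λ z → a - a * z) inv) (solve 1 (λ a → a :- a :* con 1ℚ := con 0ℚ) refl a))
      where
      one : b * i ≡ 1ℚ - - a * i
      one = trans (solve 3 (λ a b i → b :* i := (b :- a) :* i :- (:- a) :* i) refl a b i)
                  (cong (_- (- a * i)) inv)

    within-⊓ : ∀ {ε δ} → 0ℚ < ε → 0ℚ < δ →
      ∃[ γ ] (0ℚ < γ × (∀ s → ∣ s ∣ ≤ γ → ∣ s ∣ ≤ ε) × (∀ s → ∣ s ∣ ≤ γ → ∣ s ∣ ≤ δ))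
    within-⊓ {ε} {δ} 0<ε 0<δ with ≤-total ε δ
    ... | inj₁ ε≤δ = ε , 0<ε , (λ _ h → h) , λ _ h → ≤-trans h ε≤δ
    ... | inj₂ δ≤ε = δ , 0<δ , (λ _ h → ≤-trans h δ≤ε) , λ _ h → h

    neg-lin : ∀ a s b → - (- a + s * - b) ≡ a + s * b
    neg-lin = solve 3 (λ a s b → :- (:- a :+ s :* (:- b)) := a :+ s :* b) refl

    lin-from-0 : ∀ s q → 0ℚ + s * (q - 0ℚ) ≡ s * q
    lin-from-0 = solve 2 (λ s q → con 0ℚ :+ s :* (q :- con 0ℚ) := s :* q) refl

    lin-convex : ∀ a b s → a + s * (b - a) ≡ (1ℚ - s) * a + s * b
    lin-convex = solve 3 (λ a b s → a :+ s :* (b :- a) := (con 1ℚ :- s) :* a :+ s :* b) refl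

    small-perturbation⁻ : ∀ {a} b → a < 0ℚ → ∃[ ε ] (0ℚ < ε × (∀ s → ∣ s ∣ ≤ ε → a + s * b < 0ℚ))
    small-perturbation⁻ {a} b a<0 = negate (small-perturbation {a = - a} (- b) (neg-antimono-< {a} {0ℚ} a<0))
      where
      negate : ∃[ ε ] (0ℚ < ε × (∀ s → ∣ s ∣ ≤ ε → 0ℚ < - a + s * - b)) →
               ∃[ ε ] (0ℚ < ε × (∀ s → ∣ s ∣ ≤ ε → a + s * b < 0ℚ))
      negate (ε , 0<ε , near) = ε , 0<ε , λ s s≤ε →
        subst (_< 0ℚ) (neg-lin a s b) (neg-antimono-< {0ℚ} { - a + s * - b} (near s s≤ε))

    -*-zero-cancelˡ : ∀ {p q} → 0ℚ < p → - p * q ≡ 0ℚ → q ≡ 0ℚ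
    -*-zero-cancelˡ {p} {q} 0<p eq = *-zero-cancelˡ 0<p (neg-injective (trans (neg-distribˡ-* p q) eq))

    -*-pos : ∀ {p q} → 0ℚ < p → q < 0ℚ → 0ℚ < - p * q
    -*-pos {p} {q} 0<p q<0 = subst (0ℚ <_) (neg-distribˡ-* p q) (neg-antimono-< (*-neg 0<p q<0))

    -*-neg : ∀ {p q} → 0ℚ < p → 0ℚ < q → - p * q < 0ℚ
    -*-neg {p} {q} 0<p 0<q = subst (_< 0ℚ) (neg-distribˡ-* p q) (neg-antimono-< (*-pos 0<p 0<q))

    ∣p∣≤p : ∀ {p} → 0ℚ < p → ∣ p ∣ ≤ p
    ∣p∣≤p 0<p = ≤-reflexive (0≤p⇒∣p∣≡p (<⇒≤ 0<p))

    ∣-p∣≤p : ∀ {p} → 0ℚ < p → ∣ - p ∣ ≤ p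
    ∣-p∣≤p {p} 0<p = subst (_≤ p) (sym (∣-p∣≡∣p∣ p)) (∣p∣≤p 0<p)

    <⇒≱ : ∀ {p q} → p < q → ¬ q ≤ p
    <⇒≱ p<q q≤p = <-irrefl refl (<-≤-trans p<q q≤p)

    ι : ℤ → ℚ
    ι z = z ℚ./ 1

    ι≡/1 : ∀ z → ι z ≡ z ℚ./ 1
    ι≡/1 z = refl

    ι-0 : ι ℤ.0ℤ ≡ 0ℚ
    ι-0 = refl

    ι≃ : ∀ z → ℚ.toℚᵘ (ι z) ℚᵘ.≃ ℚᵘ.mkℚᵘ z 0
    ι≃ z = toℚᵘ-fromℚᵘ (ℚᵘ.mkℚᵘ z 0)

    ι-injective : ∀ {a b} → ι a ≡ ι b → a ≡ b
    ι-injective {a} {b} eq with ℚᵘ.*≡* e ← fromℚᵘ-injective {ℚᵘ.mkℚᵘ a 0} {ℚᵘ.mkℚᵘ b 0} eq =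
      trans (sym (ℤ.*-identityʳ a)) (trans e (ℤ.*-identityʳ b))

    ι-+ : ∀ a b → ι (a ℤ.+ b) ≡ ι a + ι b
    ι-+ a b = toℚᵘ-injective (ℚᵘ.≃-trans (ι≃ (a ℤ.+ b)) (ℚᵘ.≃-trans (ℚᵘ.*≡* sum)
      (ℚᵘ.≃-sym (ℚᵘ.≃-trans (toℚᵘ-homo-+ (ι a) (ι b)) (ℚᵘ.+-cong (ι≃ a) (ι≃ b))))))
      where
      sum : (a ℤ.+ b) ℤ.* (ℤ.+ 1) ≡ (a ℤ.* (ℤ.+ 1) ℤ.+ b ℤ.* (ℤ.+ 1)) ℤ.* (ℤ.+ 1)
      sum = cong (ℤ._* (ℤ.+ 1)) (sym (cong₂ ℤ._+_ (ℤ.*-identityʳ a) (ℤ.*-identityʳ b)))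

    ι-mono-< : ∀ {a b} → a ℤ.< b → ι a < ι b
    ι-mono-< {a} {b} a<b = toℚᵘ-cancel-< (ℚᵘ.<-respʳ-≃ (ℚᵘ.≃-sym (ι≃ b)) (ℚᵘ.<-respˡ-≃ (ℚᵘ.≃-sym (ι≃ a))
      (ℚᵘ.*<* (subst₂ ℤ._<_ (sym (ℤ.*-identityʳ a)) (sym (ℤ.*-identityʳ b)) a<b))))

    ι-mono-≤ : ∀ {a b} → a ℤ.≤ b → ι a ≤ ι b
    ι-mono-≤ {a} {b} a≤b = toℚᵘ-cancel-≤ (ℚᵘ.≤-respʳ-≃ (ℚᵘ.≃-sym (ι≃ b)) (ℚᵘ.≤-respˡ-≃ (ℚᵘ.≃-sym (ι≃ a))
      (ℚᵘ.*≤* (subst₂ ℤ._≤_ (sym (ℤ.*-identityʳ a)) (sym (ℤ.*-identityʳ b)) a≤b))))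

    ι-cancel-< : ∀ {a b} → ι a < ι b → a ℤ.< b
    ι-cancel-< {a} {b} lt with a ℤ.<? b
    ... | yes a<b = a<b
    ... | no a≮b  = contradiction (ι-mono-≤ (ℤ.≮⇒≥ a≮b)) (<⇒≱ lt)

    ι-cancel-≤ : ∀ {a b} → ι a ≤ ι b → a ℤ.≤ b
    ι-cancel-≤ {a} {b} le with a ℤ.≤? b
    ... | yes a≤b = a≤b
    ... | no a≰b  = contradiction le (<⇒≱ (ι-mono-< (ℤ.≰⇒> a≰b)))

    ι-pos : ∀ {a} → ℤ.0ℤ ℤ.< a → 0ℚ < ι a
    ι-pos = ι-mono-<

    ι-nonNeg : ∀ {a} → ℤ.0ℤ ℤ.≤ a → 0ℚ ≤ ι a
    ι-nonNeg = ι-mono-≤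

    ι-pos⁻¹ : ∀ {a} → 0ℚ < ι a → ℤ.0ℤ ℤ.< a
    ι-pos⁻¹ = ι-cancel-<

    ι-nonNeg⁻¹ : ∀ {a} → 0ℚ ≤ ι a → ℤ.0ℤ ℤ.≤ a
    ι-nonNeg⁻¹ = ι-cancel-≤

    -- A coordinate that is not positive becomes strictly negative when moved away from the positive
    -- value p. This is how a relative interior point of P is seen to be positive.
    pos-extends⇒pos : ∀ {x p ε} → 0ℚ < ε → 0ℚ < p → 0ℚ ≤ x + ε * (x - p) → 0ℚ < x
    pos-extends⇒pos {x} {p} {ε} 0<ε 0<p h with 0ℚ <? x
    ... | yes 0<x = 0<x
    ... | no 0≮x = contradiction h (<⇒≱ (+-mono-≤-< x≤0 (*-neg 0<ε (+-mono-≤-< x≤0 (neg-antimono-< 0<p)))))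
      where
      x≤0 : x ≤ 0ℚ
      x≤0 = ≮⇒≥ 0≮x

    lin-neg : ∀ x ε y → x + - ε * (y - x) ≡ x + ε * (x - y)
    lin-neg = solve 3 (λ x ε y → x :+ :- ε :* (y :- x) := x :+ ε :* (x :- y)) refl

    lin-diff : ∀ a b c d s → (a + s * (b - a)) - (c + s * (d - c)) ≡ (a - c) + s * ((b - d) - (a - c))
    lin-diff = solve 5 (λ a b c d s → (a :+ s :* (b :- a)) :- (c :+ s :* (d :- c)) :=
                                       (a :- c) :+ s :* ((b :- d) :- (a :- c))) refl

    lin-sum : ∀ a b c d s → (a + s * (b - a)) + (c + s * (d - c)) ≡ (a + c) + s * ((b + d) - (a + c))
    lin-sum = solve 5 (λ a b c d s → (a :+ s :* (b :- a)) :+ (c :+ s :* (d :- c)) :=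
                                      (a :+ c) :+ s :* ((b :+ d) :- (a :+ c))) refl

    lin-same : ∀ a s → a + s * (a - a) ≡ a
    lin-same = solve 2 (λ a s → a :+ s :* (a :- a) := a) refl

    lin-nonNeg-pos : ∀ {a b s} → 0ℚ ≤ a → 0ℚ < b → 0ℚ < s → s < 1ℚ → 0ℚ < a + s * (b - a)
    lin-nonNeg-pos {a} {b} {s} 0≤a 0<b 0<s s<1 = subst (0ℚ <_) (sym (lin-convex a b s))
      (+-mono-≤-< (*-nonNeg (<⇒≤ (p<q⇒0<q-p s<1)) 0≤a) (*-pos 0<s 0<b))

  small-perturbation-all : ∀ {d} (a b : Fin d → ℚ) → (∀ j → 0ℚ < a j) →
    ∃[ ε ] (0ℚ < ε × (∀ s → ∣ s ∣ ≤ ε → ∀ j → 0ℚ < a j + s * b j))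
  small-perturbation-all {zero} a b _ = 1ℚ , positive⁻¹ 1ℚ , λ _ _ ()
  small-perturbation-all {suc d} a b 0<a
    with ε , 0<ε , near ← small-perturbation (b zero) (0<a zero)
       | δ , 0<δ , close ← small-perturbation-all (a ∘ suc) (b ∘ suc) (0<a ∘ suc)
    with γ , 0<γ , ≤ε , ≤δ ← within-⊓ 0<ε 0<δ =
    γ , 0<γ , λ { s s≤γ zero → near s (≤ε s s≤γ) ; s s≤γ (suc j) → close s (≤δ s s≤γ) j }

  sumℚ-cong : ∀ {d} {f g : Fin d → ℚ} → (∀ j → f j ≡ g j) → sumℚ f ≡ sumℚ g
  sumℚ-cong {zero}  eq = refl
  sumℚ-cong {suc d} eq = cong₂ _+_ (eq zero) (sumℚ-cong (eq ∘ suc))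

  sumℚ-lin : ∀ {d} (f g : Fin d → ℚ) s →
    sumℚ (λ j → f j + s * (g j - f j)) ≡ sumℚ f + s * (sumℚ g - sumℚ f)
  sumℚ-lin {zero}  f g s = sym (lin-same 0ℚ s)
  sumℚ-lin {suc d} f g s = trans (cong (λ z → f zero + s * (g zero - f zero) + z) (sumℚ-lin (f ∘ suc) (g ∘ suc) s))
    (lin-sum (f zero) (g zero) (sumℚ (f ∘ suc)) (sumℚ (g ∘ suc)) s)

  sumℚ-scale : ∀ {d} c (f : Fin d → ℕ) → sumℚ (λ j → c * ι (ℤ.+ f j)) ≡ c * ι (ℤ.+ sumℕ f)
  sumℚ-scale {zero}  c f = sym (trans (cong (c *_) ι-0) (*-zeroʳ c))
  sumℚ-scale {suc d} c f = trans (cong (λ z → c * ι (ℤ.+ f zero) + z) (sumℚ-scale c (f ∘ suc)))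
    (trans (sym (*-distribˡ-+ c _ _)) (cong (c *_) (sym (ι-+ (ℤ.+ f zero) (ℤ.+ sumℕ (f ∘ suc))))))

  f≤sumℕ : ∀ {d} (f : Fin d → ℕ) j → f j ℕ.≤ sumℕ f
  f≤sumℕ f zero    = ℕ.m≤m+n _ _
  f≤sumℕ f (suc j) = ℕ.≤-trans (f≤sumℕ (f ∘ suc) j) (ℕ.m≤n+m _ _)

  ½<1 : ℚ.½ < 1ℚ
  ½<1 = from-yes (ℚ.½ <? 1ℚ)

open Rationals

-- The Iverson bracket.
⟦_⟧ : {P : Set} → Dec P → ℤ
⟦ yes _ ⟧ = 1ℤ
⟦ no _ ⟧  = 0ℤ

⟦⟧-true : {P : Set} (P? : Dec P) → P → ⟦ P? ⟧ ≡ 1ℤ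
⟦⟧-true (yes _) _ = refl
⟦⟧-true (no ¬p) p = contradiction p ¬p

⟦⟧-false : {P : Set} (P? : Dec P) → ¬ P → ⟦ P? ⟧ ≡ 0ℤ
⟦⟧-false (yes p) ¬p = contradiction p ¬p
⟦⟧-false (no _)  _  = refl

⟦⟧-cong : {P Q : Set} (P? : Dec P) (Q? : Dec Q) → (P → Q) → (Q → P) → ⟦ P? ⟧ ≡ ⟦ Q? ⟧
⟦⟧-cong (yes p) Q? to _   = sym (⟦⟧-true Q? (to p))
⟦⟧-cong (no ¬p) Q? _ from = sym (⟦⟧-false Q? (¬p ∘ from))

-- Affine hyperplanes cutting an open convex set

data Sign : Set where
  null pos neg : Sign

Holds : Sign → ℚ → Set
Holds null q = q ≡ 0ℚ
Holds pos  q = 0ℚ ℚ.< q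
Holds neg  q = q ℚ.< 0ℚ

data Strict : Sign → Set where
  pos : Strict pos
  neg : Strict neg

-- `S` plays the affine space, `C` an open convex subset of it, and `lin x y s` the point x + s(y -
-- x). The only linear structure is that each `φ h` is affine along such lines. Openness is
-- two-sided in s: stepping backwards from a point, away from y, is what reaches the far side of a
-- hyperplane.
record Arrangement : Set₁ where
  field
    Pt H : Set
    lin : Pt → Pt → ℚ → Pt
    φ : H → Pt → ℚ
    φ-lin : ∀ h x y s → φ h (lin x y s) ≡ φ h x ℚ.+ s ℚ.* (φ h y ℚ.- φ h x)
    S C : Pt → Set
    C-convex : ∀ {x y s} → C x → C y → 0ℚ ℚ.< s → s ℚ.< 1ℚ → C (lin x y s)
    C⊆S : ∀ {x} → C x → S x
    C-open : ∀ {x y} → C x → S y → ∃[ ε ] (0ℚ ℚ.< ε × (∀ s → ℚ.∣ s ∣ ℚ.≤ ε → C (lin x y s)))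

  Sat : List (H × Sign) → Pt → Set
  Sat cs x = All (λ hc → Holds (proj₂ hc) (φ (proj₁ hc) x)) cs

  Real : List (H × Sign) → Set
  Real cs = ∃[ x ] (C x × Sat cs x)

  on : List H → List (H × Sign)
  on = map (_, null)

  -- `h` does not contain the part of the flat inside `C`. It may miss that part altogether, so a
  -- proper `h` need not produce a new flat.
  Proper : List H → H → Set
  Proper R h = ∃[ x ] (C x × Sat (on R) x × φ h x ≢ 0ℚ)

  infix 4 _≼_ _⊑_
  _≼_ : List (H × Sign) → List (H × Sign) → Set
  cs ≼ cs′ = ∀ x → C x → Sat cs x → Sat cs′ x

  _⊑_ : List H → List H → Set
  R ⊑ R′ = on R ≼ on R′

  φ-lin-null : ∀ h {x} y s → φ h x ≡ 0ℚ → φ h (lin x y s) ≡ s ℚ.* φ h y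
  φ-lin-null h {x} y s eq = trans (φ-lin h x y s) (trans (cong (λ z → z ℚ.+ s ℚ.* (φ h y ℚ.- z)) eq)
    (lin-from-0 s (φ h y)))

  Sat-lin : ∀ R {x y} s → Sat (on R) x → Sat (on R) y → Sat (on R) (lin x y s)
  Sat-lin []      s []       []       = []
  Sat-lin (h ∷ R) {x} {y} s (p ∷ ps) (q ∷ qs) =
    trans (φ-lin-null h y s p) (trans (cong (s ℚ.*_) q) (ℚ.*-zeroʳ s)) ∷ Sat-lin R s ps qs

  Holds-open : ∀ {c} h → Strict c → ∀ {x} y → Holds c (φ h x) →
    ∃[ ε ] (0ℚ ℚ.< ε × (∀ s → ℚ.∣ s ∣ ℚ.≤ ε → Holds c (φ h (lin x y s))))
  Holds-open h pos {x} y p with ε , 0<ε , near ← small-perturbation (φ h y ℚ.- φ h x) p =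
    ε , 0<ε , λ s s≤ε → subst (0ℚ ℚ.<_) (sym (φ-lin h x y s)) (near s s≤ε)
  Holds-open h neg {x} y p with ε , 0<ε , near ← small-perturbation⁻ (φ h y ℚ.- φ h x) p =
    ε , 0<ε , λ s s≤ε → subst (ℚ._< 0ℚ) (sym (φ-lin h x y s)) (near s s≤ε)

  -- Strict conditions survive a short step in any direction, null conditions survive any step whose
  -- line lies in the flat; hence the requirement that y lies on `R` but not that it satisfies `τ`.
  Real-open : ∀ {τ} R → All (Strict ∘ proj₂) τ → ∀ {x y} → C x → Sat (τ ++ on R) x → S y → Sat (on R) y →
    ∃[ ε ] (0ℚ ℚ.< ε × (∀ s → ℚ.∣ s ∣ ℚ.≤ ε → C (lin x y s) × Sat (τ ++ on R) (lin x y s)))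
  Real-open R [] {x} {y} Cx Sx y∈S Sy with ε , 0<ε , near ← C-open Cx y∈S =
    ε , 0<ε , λ s s≤ε → near s s≤ε , Sat-lin R s Sx Sy
  Real-open {(h , _) ∷ _} R (σ ∷ σs) {x} {y} Cx (p ∷ Sx) y∈S Sy
    with ε , 0<ε , near ← Real-open R σs Cx Sx y∈S Sy | δ , 0<δ , close ← Holds-open h σ {x} y p
    with γ , 0<γ , ≤ε , ≤δ ← within-⊓ 0<ε 0<δ =
    γ , 0<γ , λ s s≤γ → near s (≤ε s s≤γ) .proj₁ , close s (≤δ s s≤γ) ∷ near s (≤ε s s≤γ) .proj₂

  φ-lin-convex : ∀ h x y s → φ h (lin x y s) ≡ (1ℚ ℚ.- s) ℚ.* φ h x ℚ.+ s ℚ.* φ h y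
  φ-lin-convex h x y s = trans (φ-lin h x y s) (lin-convex (φ h x) (φ h y) s)

  Sat-convex : ∀ {cs x y s} → Sat cs x → Sat cs y → 0ℚ ℚ.< s → s ℚ.< 1ℚ → Sat cs (lin x y s)
  Sat-convex {[]} [] [] _ _ = []
  Sat-convex {(h , c) ∷ cs} {x} {y} {s} (p ∷ ps) (q ∷ qs) 0<s s<1 =
    subst (Holds c) (sym (φ-lin-convex h x y s)) (combine c p q) ∷ Sat-convex ps qs 0<s s<1
    where
    combine : ∀ c {a b} → Holds c a → Holds c b → Holds c ((1ℚ ℚ.- s) ℚ.* a ℚ.+ s ℚ.* b)
    combine null refl refl = cong₂ ℚ._+_ (ℚ.*-zeroʳ (1ℚ ℚ.- s)) (ℚ.*-zeroʳ s)
    combine pos p q = ℚ.+-mono-< (*-pos (p<q⇒0<q-p s<1) p) (*-pos 0<s q)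
    combine neg p q = ℚ.+-mono-< (*-neg (p<q⇒0<q-p s<1) p) (*-neg 0<s q)

  -- The segment joining the two sides meets `h`, and all the other conditions are convex.
  cross : ∀ {h cs} → Real ((h , neg) ∷ cs) → Real ((h , pos) ∷ cs) → Real ((h , null) ∷ cs)
  cross {h} (x , Cx , x<0 ∷ Sx) (y , Cy , 0<y ∷ Sy) with s , 0<s , s<1 , eq ← zero-crossing x<0 0<y =
    lin x y s , C-convex Cx Cy 0<s s<1 , trans (φ-lin h x y s) eq ∷ Sat-convex Sx Sy 0<s s<1

  -- Properness gives a point y of the flat off `h`. From x on `h`, the steps of ε and -ε along the
  -- line through y stay in the flat and end on opposite sides of `h`.
  both-sides : ∀ {τ R h} → All (Strict ∘ proj₂) τ → Proper R h → Real ((h , null) ∷ τ ++ on R) →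
    Real ((h , pos) ∷ τ ++ on R) × Real ((h , neg) ∷ τ ++ on R)
  both-sides {τ} {R} {h} σs (y , Cy , Sy , y≢0) (x , Cx , x≡0 ∷ Sx)
    with ε , 0<ε , near ← Real-open R σs Cx Sx (C⊆S Cy) Sy = answer
    where
    at : ∀ {c} s → ℚ.∣ s ∣ ℚ.≤ ε → Holds c (s ℚ.* φ h y) → Real ((h , c) ∷ τ ++ on R)
    at {c} s s≤ε p = lin x y s , near s s≤ε .proj₁ ,
      subst (Holds c) (sym (φ-lin-null h y s x≡0)) p ∷ near s s≤ε .proj₂
    answer : Real ((h , pos) ∷ τ ++ on R) × Real ((h , neg) ∷ τ ++ on R)
    answer with ℚ.<-cmp (φ h y) 0ℚ
    ... | tri< y<0 _ _ =
      at (ℚ.- ε) (∣-p∣≤p 0<ε) (-*-pos 0<ε y<0) ,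
      at ε (∣p∣≤p 0<ε) (*-neg 0<ε y<0)
    ... | tri≈ _ y≡0 _ = contradiction y≡0 y≢0
    ... | tri> _ _ 0<y =
      at ε (∣p∣≤p 0<ε) (*-pos 0<ε 0<y) ,
      at (ℚ.- ε) (∣-p∣≤p 0<ε) (-*-neg 0<ε 0<y)

  Real-split : ∀ {h cs} → Real cs → Real ((h , null) ∷ cs) ⊎ Real ((h , pos) ∷ cs) ⊎ Real ((h , neg) ∷ cs)
  Real-split {h} (x , Cx , Sx) with ℚ.<-cmp (φ h x) 0ℚ
  ... | tri< x<0 _ _ = inj₂ (inj₂ (x , Cx , x<0 ∷ Sx))
  ... | tri≈ _ x≡0 _ = inj₁ (x , Cx , x≡0 ∷ Sx)
  ... | tri> _ _ 0<x = inj₂ (inj₁ (x , Cx , 0<x ∷ Sx))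

  Real-tail : ∀ {hc cs} → Real (hc ∷ cs) → Real cs
  Real-tail (x , Cx , _ ∷ Sx) = x , Cx , Sx

  -- The witness is the point where the segment from x to y crosses `h`. There `φ k` is a convex
  -- combination, with both weights positive, of one zero and one nonzero value.
  Proper-between : ∀ {R h k x y} → C x → Sat (on R) x → C y → Sat (on R) y →
    φ h x ℚ.< 0ℚ → 0ℚ ℚ.< φ h y →
    (φ k x ≡ 0ℚ × φ k y ≢ 0ℚ) ⊎ (φ k x ≢ 0ℚ × φ k y ≡ 0ℚ) → Proper (h ∷ R) k
  Proper-between {R} {h} {k} {x} {y} Cx Sx Cy Sy x<0 0<y off
    with s , 0<s , s<1 , eq ← zero-crossing x<0 0<y =
    lin x y s , C-convex Cx Cy 0<s s<1 , trans (φ-lin h x y s) eq ∷ Sat-lin R s Sx Sy ,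
    λ k≡0 → off⇒⊥ off (trans (sym (φ-lin-convex k x y s)) k≡0)
    where
    off⇒⊥ : ∀ {a b} → (a ≡ 0ℚ × b ≢ 0ℚ) ⊎ (a ≢ 0ℚ × b ≡ 0ℚ) → (1ℚ ℚ.- s) ℚ.* a ℚ.+ s ℚ.* b ≢ 0ℚ
    off⇒⊥ {b = b} (inj₁ (refl , b≢0)) eq = b≢0 (*-zero-cancelˡ 0<s
      (trans (sym (ℚ.+-identityˡ _)) (trans (cong (ℚ._+ s ℚ.* b) (sym (ℚ.*-zeroʳ (1ℚ ℚ.- s)))) eq)))
    off⇒⊥ {a} (inj₂ (a≢0 , refl)) eq = a≢0 (*-zero-cancelˡ (p<q⇒0<q-p s<1)
      (trans (sym (ℚ.+-identityʳ _)) (trans (cong ((1ℚ ℚ.- s) ℚ.* a ℚ.+_) (sym (ℚ.*-zeroʳ s))) eq)))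

  -- If h cuts u ∩ k properly then k cuts u ∩ h properly: both parts of u have codimension one.
  exchange : ∀ {R h k} → Real (on (h ∷ k ∷ R)) → Proper R k → Proper (k ∷ R) h → Proper (h ∷ R) k
  exchange {R} {h} {k} (z , Cz , z∈h ∷ z∈k ∷ z∈R) (q , Cq , q∈R , q∉k) (p , Cp , p∈k ∷ p∈R , p∉h)
    with ε , 0<ε , near ← C-open Cz (C⊆S Cq) = by-sign (ℚ.<-cmp (φ h q) 0ℚ) (ℚ.<-cmp (φ h p) 0ℚ)
    where
    -- q reflected through z, shrunk by ε to stay in `C`: it lies on the other side of `h` from q
    -- and still off `k`. It replaces q when p and q are on the same side of `h`.
    q′ : Pt
    q′ = lin z q (ℚ.- ε)
    Cq′ : C q′
    Cq′ = near (ℚ.- ε) (∣-p∣≤p 0<ε)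
    q′∈R : Sat (on R) q′
    q′∈R = Sat-lin R (ℚ.- ε) z∈R q∈R
    q′∉k : φ k q′ ≢ 0ℚ
    q′∉k eq = q∉k (-*-zero-cancelˡ 0<ε (trans (sym (φ-lin-null k q (ℚ.- ε) z∈k)) eq))
    φhq′ : ℚ.- ε ℚ.* φ h q ≡ φ h q′
    φhq′ = sym (φ-lin-null h q (ℚ.- ε) z∈h)
    by-sign : Tri (φ h q ℚ.< 0ℚ) (φ h q ≡ 0ℚ) (φ h q ℚ.> 0ℚ) →
              Tri (φ h p ℚ.< 0ℚ) (φ h p ≡ 0ℚ) (φ h p ℚ.> 0ℚ) → Proper (h ∷ R) k
    by-sign (tri≈ _ q∈h _) _ = q , Cq , q∈h ∷ q∈R , q∉k
    by-sign _ (tri≈ _ p∈h _) = contradiction p∈h p∉h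
    by-sign (tri< q<0 _ _) (tri> _ _ 0<p) = Proper-between Cq q∈R Cp p∈R q<0 0<p (inj₂ (q∉k , p∈k))
    by-sign (tri> _ _ 0<q) (tri< p<0 _ _) = Proper-between Cp p∈R Cq q∈R p<0 0<q (inj₁ (p∈k , q∉k))
    by-sign (tri< q<0 _ _) (tri< p<0 _ _) = Proper-between Cp p∈R Cq′ q′∈R p<0
      (subst (0ℚ ℚ.<_) φhq′ (-*-pos 0<ε q<0)) (inj₁ (p∈k , q′∉k))
    by-sign (tri> _ _ 0<q) (tri> _ _ 0<p) = Proper-between Cq′ q′∈R Cp p∈R
      (subst (ℚ._< 0ℚ) φhq′ (-*-neg 0<ε 0<q)) 0<p (inj₂ (q′∉k , p∈k))

  -- From z in `C` a short step towards x stays in `C` and in the flat of `R`, hence in that of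
  -- `R′`. An affine function that vanishes at z and after the step vanishes on the whole line, so
  -- at x, which may lie outside `C`.
  Flat-⊑ : ∀ {R R′} → Real (on R) → R ⊑ R′ → ∀ {x} → S x → Sat (on R) x → Sat (on R′) x
  Flat-⊑ {R} {R′} (z , Cz , z∈R) R⊑R′ {x} x∈S x∈R with ε , 0<ε , near ← C-open Cz x∈S =
    pull R′ (R⊑R′ z Cz z∈R)
      (R⊑R′ (lin z x ε) (near ε (∣p∣≤p 0<ε)) (Sat-lin R ε z∈R x∈R))
    where
    pull : ∀ T → Sat (on T) z → Sat (on T) (lin z x ε) → Sat (on T) x
    pull []      []        []        = []
    pull (h ∷ T) (z∈h ∷ zs) (l∈h ∷ ls) =
      *-zero-cancelˡ 0<ε (trans (sym (φ-lin-null h x ε z∈h)) l∈h) ∷ pull T zs ls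

  sign-open : ∀ h x y → ∃[ ε ] (0ℚ ℚ.< ε × (∀ s → ℚ.∣ s ∣ ℚ.≤ ε → ∀ {c} → Strict c →
    Holds c (φ h x) → Holds c (φ h (lin x y s))))
  sign-open h x y with ℚ.<-cmp (φ h x) 0ℚ
  ... | tri< x<0 _ x≯0 with ε , 0<ε , near ← Holds-open h neg {x} y x<0 =
    ε , 0<ε , λ { s s≤ε pos 0<x → contradiction 0<x x≯0 ; s s≤ε neg _ → near s s≤ε }
  sign-open h x y | tri≈ x≮0 _ x≯0 =
    1ℚ , ℚ.positive⁻¹ 1ℚ , λ { _ _ pos 0<x → contradiction 0<x x≯0 ; _ _ neg x<0 → contradiction x<0 x≮0 }
  sign-open h x y | tri> x≮0 _ 0<x with ε , 0<ε , near ← Holds-open h pos {x} y 0<x =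
    ε , 0<ε , λ { s s≤ε pos _ → near s s≤ε ; s s≤ε neg x<0 → contradiction x<0 x≮0 }

  signs-open : ∀ B x y → ∃[ ε ] (0ℚ ℚ.< ε × (∀ s → ℚ.∣ s ∣ ℚ.≤ ε → ∀ {h c} → h ∈ B → Strict c →
    Holds c (φ h x) → Holds c (φ h (lin x y s))))
  signs-open [] x y = 1ℚ , ℚ.positive⁻¹ 1ℚ , λ _ _ ()
  signs-open (h ∷ B) x y
    with ε , 0<ε , near ← signs-open B x y | δ , 0<δ , close ← sign-open h x y
    with γ , 0<γ , ≤ε , ≤δ ← within-⊓ 0<ε 0<δ =
    γ , 0<γ , λ { s s≤γ (here refl) → close s (≤δ s s≤γ) ; s s≤γ (there i) → near s (≤ε s s≤γ) i }

-- Signed sums over sublists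

module Tree {H : Set} where
  open import Data.Integer using (_+_; _*_; -_)
  open ℤ-Solver.+-*-Solver using (solve; _:+_; _:*_; :-_; _:-_; con; _:=_)

  -- The sum over the sublists S of A of β (S ∪ R), weighted by the product of the σ met on the way.
  tree : (List H → H → ℤ) → (List H → ℤ) → List H → List H → ℤ
  tree σ β R []      = β R
  tree σ β R (h ∷ A) = tree σ β R A + σ R h * tree σ β (h ∷ R) A

  tree-cong : ∀ {T : H → Set} {σ β β′} → (∀ {R} → All T R → β R ≡ β′ R) →
    ∀ {R A} → All T R → All T A → tree σ β R A ≡ tree σ β′ R A
  tree-cong eq r [] = eq r
  tree-cong {σ = σ} eq {R} {h ∷ _} r (a ∷ as) =
    cong₂ (λ x y → x + σ R h * y) (tree-cong {σ = σ} eq r as) (tree-cong {σ = σ} eq (a ∷ r) as)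

  tree-zero : ∀ {T : H → Set} {σ β} → (∀ {R} → ¬ All T R → β R ≡ 0ℤ) →
    ∀ {R} A → ¬ All T R → tree σ β R A ≡ 0ℤ
  tree-zero z [] ¬r = z ¬r
  tree-zero {σ = σ} z {R} (h ∷ A) ¬r = trans
    (cong₂ (λ x y → x + σ R h * y) (tree-zero {σ = σ} z A ¬r) (tree-zero {σ = σ} z A (¬r ∘ All.tail)))
    (trans (ℤ.+-identityˡ _) (ℤ.*-zeroʳ (σ R h)))

  -- Every sublist that uses an element outside `T` ends in a value of `β` that vanishes.
  tree-filter : ∀ {T : H → Set} (T? : Decidable T) {σ β} → (∀ {R} → ¬ All T R → β R ≡ 0ℤ) →
    ∀ R A → tree σ β R A ≡ tree σ β R (filter T? A)
  tree-filter T? z R [] = refl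
  tree-filter T? {σ} {β} z R (h ∷ A) with T? h
  ... | yes _ = cong₂ (λ x y → x + σ R h * y) (tree-filter T? {σ} z R A) (tree-filter T? {σ} z (h ∷ R) A)
  ... | no ¬t = trans
    (cong₂ (λ x y → x + σ R h * y) (tree-filter T? {σ} z R A) (tree-zero {σ = σ} z A (¬t ∘ All.head)))
    (trans (cong (λ z → tree σ β R (filter T? A) + z) (ℤ.*-zeroʳ (σ R h))) (ℤ.+-identityʳ _))

  isEmpty : List H → ℤ
  isEmpty []      = 1ℤ
  isEmpty (_ ∷ _) = 0ℤ

  -- The sublists with and without the first element cancel in pairs; only an empty list leaves a
  -- term.
  tree-alternating : ∀ {T : H → Set} {β} → (∀ {R} → All T R → β R ≡ 1ℤ) →
    ∀ {R A} → All T R → All T A → tree (λ _ _ → -1ℤ) β R A ≡ isEmpty A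
  tree-alternating one r [] = one r
  tree-alternating one {R} {h ∷ A} r (a ∷ as) = trans
    (cong₂ (λ x y → x + -1ℤ * y) (tree-alternating one r as) (tree-alternating one (a ∷ r) as))
    (solve 1 (λ x → x :+ con -1ℤ :* x := con 0ℤ) refl (isEmpty A))

-- Regions by deletion and restriction, and the parity of codimension

module Regions (Ar : Arrangement) (dec : ∀ cs → Dec (Arrangement.Real Ar cs)) where
  open import Data.Integer using (_+_; _*_; -_)
  open ℤ-Solver.+-*-Solver using (solve; _:+_; _:*_; :-_; _:-_; con; _:=_)

  open Arrangement Ar
  open Tree {H} public

  ≼-∷ : ∀ {c cs cs′} → cs ≼ cs′ → c ∷ cs ≼ c ∷ cs′
  ≼-∷ imp x Cx (p ∷ ps) = p ∷ imp x Cx ps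

  ≼-swap : ∀ {c d cs} → c ∷ d ∷ cs ≼ d ∷ c ∷ cs
  ≼-swap x Cx (p ∷ q ∷ ps) = q ∷ p ∷ ps

  Real-≼ : ∀ {cs cs′} → cs ≼ cs′ → Real cs → Real cs′
  Real-≼ imp (x , Cx , Sx) = x , Cx , imp x Cx Sx

  proper? : ∀ R h → Dec (Proper R h)
  proper? R h with dec ((h , pos) ∷ on R) | dec ((h , neg) ∷ on R)
  ... | yes (x , Cx , 0<x ∷ Sx) | _ = yes (x , Cx , Sx , λ eq → ℚ.<⇒≢ 0<x (sym eq))
  ... | no _ | yes (x , Cx , x<0 ∷ Sx) = yes (x , Cx , Sx , λ eq → ℚ.<⇒≢ x<0 eq)
  ... | no ¬p | no ¬n = no λ (x , Cx , Sx , x≢0) → split x Cx Sx x≢0 (ℚ.<-cmp (φ h x) 0ℚ)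
    where
    split : ∀ x → C x → Sat (on R) x → φ h x ≢ 0ℚ → ¬ Tri (φ h x ℚ.< 0ℚ) (φ h x ≡ 0ℚ) (φ h x ℚ.> 0ℚ)
    split x Cx Sx x≢0 (tri< x<0 _ _) = ¬n (x , Cx , x<0 ∷ Sx)
    split x Cx Sx x≢0 (tri≈ _ x≡0 _) = x≢0 x≡0
    split x Cx Sx x≢0 (tri> _ _ 0<x) = ¬p (x , Cx , 0<x ∷ Sx)

  ¬Proper⇒φ≡0 : ∀ {R h} → ¬ Proper R h → ∀ {x} → C x → Sat (on R) x → φ h x ≡ 0ℚ
  ¬Proper⇒φ≡0 {h = h} ¬pr {x} Cx Sx with φ h x ℚ.≟ 0ℚ
  ... | yes eq = eq
  ... | no neq = contradiction (x , Cx , Sx , neq) ¬pr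

  ¬Proper⇒⊑ : ∀ {R h} → ¬ Proper R h → R ⊑ h ∷ R
  ¬Proper⇒⊑ ¬pr x Cx Sx = ¬Proper⇒φ≡0 ¬pr Cx Sx ∷ Sx

  Proper-⊑ : ∀ {R R′ h} → R ⊑ R′ → Proper R h → Proper R′ h
  Proper-⊑ R⊑R′ (x , Cx , Sx , x≢0) = x , Cx , R⊑R′ x Cx Sx , x≢0

  sgn : {P : Set} → Dec P → ℤ
  sgn (yes _) = 1ℤ
  sgn (no _)  = -1ℤ

  sgn-cong : {P Q : Set} (P? : Dec P) (Q? : Dec Q) → (P → Q) → (Q → P) → sgn P? ≡ sgn Q?
  sgn-cong (yes _) (yes _) _ _ = refl
  sgn-cong (no _)  (no _)  _ _ = refl
  sgn-cong (yes p) (no ¬q) f _ = contradiction (f p) ¬q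
  sgn-cong (no ¬p) (yes q) _ g = contradiction (g q) ¬p

  sgn-false : {P : Set} (P? : Dec P) → ¬ P → sgn P? ≡ -1ℤ
  sgn-false (yes p) ¬p = contradiction p ¬p
  sgn-false (no _)  _  = refl

  -- Adding `h` raises the number of chosen hyperplanes by one, and the codimension by one exactly
  -- when `h` is proper. So the product of these signs along a realizable S is (-1)^(|S| - codim
  -- ⋂S).
  σ : List H → H → ℤ
  σ R h = sgn (proper? R h)

  σ-cong : ∀ {R R′} h → R ⊑ R′ → R′ ⊑ R → σ R h ≡ σ R′ h
  σ-cong h ⊑₁ ⊑₂ = sgn-cong (proper? _ h) (proper? _ h) (Proper-⊑ ⊑₁) (Proper-⊑ ⊑₂)

  -- A region is recorded as a realizable choice of strict signs: by convexity each choice cuts out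
  -- at most one piece.
  regions : List (H × Sign) → List H → ℤ
  regions cs []      = ⟦ dec cs ⟧
  regions cs (h ∷ A) = regions ((h , pos) ∷ cs) A + regions ((h , neg) ∷ cs) A

  regions-cong : ∀ {cs cs′} → cs ≼ cs′ → cs′ ≼ cs → ∀ A → regions cs A ≡ regions cs′ A
  regions-cong i j []      = ⟦⟧-cong (dec _) (dec _) (Real-≼ i) (Real-≼ j)
  regions-cong i j (h ∷ A) = cong₂ _+_ (regions-cong (≼-∷ i) (≼-∷ j) A) (regions-cong (≼-∷ i) (≼-∷ j) A)

  regions-unreal : ∀ {cs} → ¬ Real cs → ∀ A → regions cs A ≡ 0ℤ
  regions-unreal ¬real []      = ⟦⟧-false (dec _) ¬real
  regions-unreal ¬real (h ∷ A) =
    cong₂ _+_ (regions-unreal (¬real ∘ Real-tail) A) (regions-unreal (¬real ∘ Real-tail) A)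

  -- If `h` meets the cell, it has points on both sides and the count is 2 = 1 + 1. If not, a
  -- nonempty cell lies on one side only, since `cross` would produce a point on `h`; the count is
  -- then 1 = 1 + 0.
  deletion-restriction₀ : ∀ {τ R h} → All (Strict ∘ proj₂) τ → Proper R h → let cs = τ ++ on R in
    ⟦ dec ((h , pos) ∷ cs) ⟧ + ⟦ dec ((h , neg) ∷ cs) ⟧ ≡ ⟦ dec cs ⟧ + ⟦ dec ((h , null) ∷ cs) ⟧
  deletion-restriction₀ {τ} {R} {h} σs pr with dec ((h , null) ∷ τ ++ on R)
  ... | yes real = cong₂ _+_
    (trans (⟦⟧-true (dec _) (both-sides σs pr real .proj₁)) (sym (⟦⟧-true (dec _) (Real-tail real))))
    (⟦⟧-true (dec _) (both-sides σs pr real .proj₂))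
  ... | no ¬null with dec (τ ++ on R)
  ...   | no ¬real = cong₂ _+_ (⟦⟧-false (dec _) (¬real ∘ Real-tail)) (⟦⟧-false (dec _) (¬real ∘ Real-tail))
  ...   | yes real with Real-split {h} real
  ...     | inj₁ z = contradiction z ¬null
  ...     | inj₂ (inj₁ p) = cong₂ _+_ (⟦⟧-true (dec _) p) (⟦⟧-false (dec _) λ n → ¬null (cross n p))
  ...     | inj₂ (inj₂ n) = cong₂ _+_ (⟦⟧-false (dec _) λ p → ¬null (cross n p)) (⟦⟧-true (dec _) n)

  -- The induction splits on the next `g` and moves its strict sign into `τ`, which is why strict
  -- conditions are carried beside the null ones.
  deletion-restriction : ∀ {τ R h} → All (Strict ∘ proj₂) τ → Proper R h → ∀ A → let cs = τ ++ on R in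
    regions ((h , pos) ∷ cs) A + regions ((h , neg) ∷ cs) A ≡ regions cs A + regions ((h , null) ∷ cs) A
  deletion-restriction σs pr [] = deletion-restriction₀ σs pr
  deletion-restriction {τ} {R} {h} σs pr (g ∷ A) = begin
      (ρ g pos h pos + ρ g neg h pos) + (ρ g pos h neg + ρ g neg h neg)
    ≡⟨ interchange (ρ g pos h pos) _ _ _ ⟩
      (ρ g pos h pos + ρ g pos h neg) + (ρ g neg h pos + ρ g neg h neg)
    ≡⟨ cong₂ _+_ (cong₂ _+_ (swap pos pos) (swap pos neg)) (cong₂ _+_ (swap neg pos) (swap neg neg)) ⟩
      (ρ h pos g pos + ρ h neg g pos) + (ρ h pos g neg + ρ h neg g neg)
    ≡⟨ cong₂ _+_ (deletion-restriction (pos ∷ σs) pr A) (deletion-restriction (neg ∷ σs) pr A) ⟩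
      (ρ₁ pos + ρ h null g pos) + (ρ₁ neg + ρ h null g neg)
    ≡⟨ cong₂ (λ x y → (ρ₁ pos + x) + (ρ₁ neg + y)) (sym (swap pos null)) (sym (swap neg null)) ⟩
      (ρ₁ pos + ρ g pos h null) + (ρ₁ neg + ρ g neg h null)
    ≡⟨ interchange (ρ₁ pos) _ _ _ ⟩
      (ρ₁ pos + ρ₁ neg) + (ρ g pos h null + ρ g neg h null) ∎
    where
    open ≡-Reasoning
    ρ : H → Sign → H → Sign → ℤ
    ρ h c g d = regions ((h , c) ∷ (g , d) ∷ τ ++ on R) A
    ρ₁ : Sign → ℤ
    ρ₁ d = regions ((g , d) ∷ τ ++ on R) A
    swap : ∀ d c → ρ g d h c ≡ ρ h c g d
    swap d c = regions-cong ≼-swap ≼-swap A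
    interchange : ∀ a b c d → (a + b) + (c + d) ≡ (a + c) + (b + d)
    interchange = solve 4 (λ a b c d → (a :+ b) :+ (c :+ d) := (a :+ c) :+ (b :+ d)) refl

  -- For proper `h` this is deletion and restriction with sign +1. For improper `h` neither strict
  -- side meets the flat, so the left side is 0; on the right `R` and `h ∷ R` describe the same flat
  -- and occur with opposite signs.
  regions≡tree : ∀ R A → regions (on R) A ≡ tree σ (λ R → ⟦ dec (on R) ⟧) R A
  regions≡tree R [] = refl
  regions≡tree R (h ∷ A) with proper? R h
  ... | yes pr = trans (deletion-restriction [] pr A)
    (cong₂ _+_ (regions≡tree R A) (trans (regions≡tree (h ∷ R) A) (sym (ℤ.*-identityˡ _))))
  ... | no ¬pr = trans (cong₂ _+_ (regions-unreal (¬strict pos) A) (regions-unreal (¬strict neg) A))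
    (sym (trans (cong₂ (λ x y → x + -1ℤ * y) (trans (sym (regions≡tree R A)) same) (sym (regions≡tree (h ∷ R) A)))
      (solve 1 (λ x → x :+ con -1ℤ :* x := con 0ℤ) refl (regions (on (h ∷ R)) A))))
    where
    ¬strict : ∀ {c} → Strict c → ¬ Real ((h , c) ∷ on R)
    ¬strict pos (x , Cx , 0<x ∷ Sx) = ¬pr (x , Cx , Sx , λ eq → ℚ.<⇒≢ 0<x (sym eq))
    ¬strict neg (x , Cx , x<0 ∷ Sx) = ¬pr (x , Cx , Sx , ℚ.<⇒≢ x<0)
    same : regions (on R) A ≡ regions (on (h ∷ R)) A
    same = regions-cong (¬Proper⇒⊑ ¬pr) (λ { x Cx (_ ∷ Sx) → Sx }) A

  -- The parity of the codimension of ⋂ R.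
  parity : List H → ℤ
  parity []      = 1ℤ
  parity (h ∷ R) = - (σ R h * parity R)

  -- Two properly cutting hyperplanes are handled by `exchange`. If one is improper over `R`, adding
  -- it does not change the flat, and it stays improper on every smaller flat.
  σ-swap : ∀ R h k → Real (on (h ∷ k ∷ R)) → σ (k ∷ R) h * σ R k ≡ σ (h ∷ R) k * σ R h
  σ-swap R h k real = by-cases (proper? R h) (proper? R k)
    where
    improper : ∀ h k → ¬ Proper R h → σ (k ∷ R) h * σ R k ≡ σ (h ∷ R) k * σ R h
    improper h k ¬h = trans (ℤ.*-comm (σ (k ∷ R) h) (σ R k)) (cong₂ _*_
      (σ-cong k (¬Proper⇒⊑ ¬h) (λ { x Cx (_ ∷ Sx) → Sx }))
      (sgn-cong (proper? (k ∷ R) h) (proper? R h) (Proper-⊑ λ { x Cx (_ ∷ Sx) → Sx })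
        (λ ph → contradiction ph ¬h)))
    by-cases : Dec (Proper R h) → Dec (Proper R k) → σ (k ∷ R) h * σ R k ≡ σ (h ∷ R) k * σ R h
    by-cases (yes ph) (yes pk) = cong₂ _*_
      (sgn-cong (proper? (k ∷ R) h) (proper? (h ∷ R) k) (exchange real pk) (exchange (Real-≼ ≼-swap real) ph))
      (sgn-cong (proper? R k) (proper? R h) (const ph) (const pk))
    by-cases (no ¬h) _ = improper h k ¬h
    by-cases _ (no ¬k) = sym (improper k h ¬k)

  ⊑-↭ : ∀ {R R′} → R ↭ R′ → R ⊑ R′
  ⊑-↭ p x Cx = Perm.All-resp-↭ (Perm.map⁺ (_, null) p)

  parity-∷ : ∀ h {R R′} → R ↭ R′ → parity R ≡ parity R′ → parity (h ∷ R) ≡ parity (h ∷ R′)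
  parity-∷ h p eq = cong₂ (λ x y → - (x * y)) (σ-cong h (⊑-↭ p) (⊑-↭ (Perm.↭-sym p))) eq

  parity-↭ : ∀ {R R′} → R ↭ R′ → Real (on R) → parity R ≡ parity R′
  parity-↭ Perm.refl _ = refl
  parity-↭ (Perm.prep h p) real = parity-∷ h p (parity-↭ p (Real-tail real))
  parity-↭ {h ∷ k ∷ R} {_ ∷ _ ∷ R′} (Perm.swap _ _ p) real = begin
    - (σ (k ∷ R) h * - (σ R k * parity R))  ≡⟨ assoc (σ (k ∷ R) h) _ _ ⟩
    σ (k ∷ R) h * σ R k * parity R          ≡⟨ cong (_* parity R) (σ-swap R h k real) ⟩
    σ (h ∷ R) k * σ R h * parity R          ≡⟨ sym (assoc (σ (h ∷ R) k) _ _) ⟩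
    parity (k ∷ h ∷ R)
      ≡⟨ parity-∷ k (Perm.prep h p) (parity-∷ h p (parity-↭ p (Real-tail (Real-tail real)))) ⟩
    parity (k ∷ h ∷ R′)                     ∎
    where
    open ≡-Reasoning
    assoc : ∀ a b c → - (a * - (b * c)) ≡ a * b * c
    assoc = solve 3 (λ a b c → :- (a :* (:- (b :* c))) := a :* b :* c) refl
  parity-↭ (Perm.trans p q) real = trans (parity-↭ p real) (parity-↭ q (Real-≼ (⊑-↭ p) real))

  parity-++ : ∀ {R} T → R ⊑ T → parity (T ++ R) ≡ parity R
  parity-++ [] _ = refl
  parity-++ {R} (h ∷ T) R⊑T = trans
    (cong₂ (λ x y → - (x * y)) (sgn-false (proper? (T ++ R) h) ¬pr) (parity-++ T λ x Cx Sx → All.tail (R⊑T x Cx Sx)))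
    (solve 1 (λ p → :- (con -1ℤ :* p) := p) refl (parity R))
    where
    ¬pr : ¬ Proper (T ++ R) h
    ¬pr (x , Cx , Sx , x∉h) = x∉h (All.head (R⊑T x Cx
      (All.++⁻ʳ (on T) (subst (λ cs → Sat cs x) (List.map-++ (_, null) T R) Sx))))

  -- Both lists have the parity of their concatenation: read in one order the elements of `R′` are
  -- all improper, read in the other those of `R`. So the parity depends on the flat alone.
  parity-cong : ∀ {R R′} → Real (on R) → R ⊑ R′ → R′ ⊑ R → parity R ≡ parity R′
  parity-cong {R} {R′} real ⊑₁ ⊑₂ = trans (sym (parity-++ R′ ⊑₁))
    (trans (parity-↭ (Perm.++-comm R′ R) both) (parity-++ R ⊑₂))
    where
    both : Real (on (R′ ++ R))
    both = Real-≼ (λ x Cx Sx → subst (λ cs → Sat cs x) (sym (List.map-++ (_, null) R′ R))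
                                 (All.++⁺ (⊑₁ x Cx Sx) Sx)) real

-- Finite sums and counting by fibres

module Sums where

  open import Data.Integer using (_+_; _*_)
  open ℤ-Solver.+-*-Solver using (solve; _:+_; _:*_; con; _:=_)

  sumℤ-cong : ∀ {m} {f g : Fin m → ℤ} → (∀ b → f b ≡ g b) → sumℤ f ≡ sumℤ g
  sumℤ-cong {zero}  eq = refl
  sumℤ-cong {suc m} eq = cong₂ _+_ (eq zero) (sumℤ-cong (eq ∘ suc))

  sumℤ-zero : ∀ {m} {f : Fin m → ℤ} → (∀ b → f b ≡ 0ℤ) → sumℤ f ≡ 0ℤ
  sumℤ-zero {zero}  eq = refl
  sumℤ-zero {suc m} eq = cong₂ _+_ (eq zero) (sumℤ-zero (eq ∘ suc))

  sumℤ-linear : ∀ {m} (f g : Fin m → ℤ) c → sumℤ (λ b → f b + c * g b) ≡ sumℤ f + c * sumℤ g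
  sumℤ-linear {zero}  f g c = sym (trans (ℤ.+-identityˡ _) (ℤ.*-zeroʳ c))
  sumℤ-linear {suc m} f g c = trans (cong (λ z → f zero + c * g zero + z) (sumℤ-linear (f ∘ suc) (g ∘ suc) c))
    (solve 5 (λ x y c s t → x :+ c :* y :+ (s :+ c :* t) := x :+ s :+ c :* (y :+ t)) refl
      (f zero) (g zero) c (sumℤ (f ∘ suc)) (sumℤ (g ∘ suc)))

  sumℤ-+ : ∀ {m} (f g : Fin m → ℤ) → sumℤ (λ b → f b + g b) ≡ sumℤ f + sumℤ g
  sumℤ-+ f g = trans (sumℤ-cong λ b → cong (λ z → f b + z) (sym (ℤ.*-identityˡ (g b))))
    (trans (sumℤ-linear f g 1ℤ) (cong (λ z → sumℤ f + z) (ℤ.*-identityˡ (sumℤ g))))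

  sumℤ-δ : ∀ {m} (f : Fin m → ℤ) a → sumℤ (λ b → f b * ⟦ a Fin.≟ b ⟧) ≡ f a
  sumℤ-δ f zero = trans
    (cong₂ _+_ (ℤ.*-identityʳ (f zero)) (sumℤ-zero λ b → ℤ.*-zeroʳ (f (suc b)))) (ℤ.+-identityʳ (f zero))
  sumℤ-δ f (suc a) = trans (cong₂ _+_ (ℤ.*-zeroʳ (f zero))
    (trans (sumℤ-cong λ b → cong (λ z → f (suc b) * z)
      (⟦⟧-cong (suc a Fin.≟ suc b) (a Fin.≟ b) Fin.suc-injective (cong suc))) (sumℤ-δ (f ∘ suc) a)))
    (ℤ.+-identityˡ _)

  sumL : {K : Set} → (K → ℤ) → List K → ℤ
  sumL f []       = 0ℤ
  sumL f (y ∷ ys) = f y + sumL f ys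

  sumL-cong : {K : Set} {f g : K → ℤ} {ys : List K} → (∀ {y} → y ∈ ys → f y ≡ g y) → sumL f ys ≡ sumL g ys
  sumL-cong {ys = []}     eq = refl
  sumL-cong {ys = y ∷ ys} eq = cong₂ _+_ (eq (here refl)) (sumL-cong (eq ∘ there))

  sumL-+ : {K : Set} (f g : K → ℤ) (ys : List K) → sumL (λ y → f y + g y) ys ≡ sumL f ys + sumL g ys
  sumL-+ f g []       = refl
  sumL-+ f g (y ∷ ys) = trans (cong (λ z → f y + g y + z) (sumL-+ f g ys))
    (solve 4 (λ a b c d → a :+ b :+ (c :+ d) := a :+ c :+ (b :+ d)) refl (f y) (g y) (sumL f ys) (sumL g ys))

  sumL-0 : {K : Set} (ys : List K) → sumL (λ _ → 0ℤ) ys ≡ 0ℤ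
  sumL-0 []       = refl
  sumL-0 (y ∷ ys) = trans (ℤ.+-identityˡ _) (sumL-0 ys)

  sumL-sumℤ : ∀ {K : Set} {m} (c : Fin m → ℤ) (f : Fin m → K → ℤ) ys →
    sumℤ (λ a → c a * sumL (f a) ys) ≡ sumL (λ y → sumℤ (λ a → f a y * c a)) ys
  sumL-sumℤ c f [] = sumℤ-zero λ a → ℤ.*-zeroʳ (c a)
  sumL-sumℤ c f (y ∷ ys) = trans
    (sumℤ-cong λ a → solve 3 (λ c x s → c :* (x :+ s) := x :* c :+ con 1ℤ :* (c :* s)) refl (c a) (f a y) (sumL (f a) ys))
    (trans (sumℤ-linear (λ a → f a y * c a) (λ a → c a * sumL (f a) ys) 1ℤ)
      (cong (λ z → sumℤ (λ a → f a y * c a) + z) (trans (ℤ.*-identityˡ _) (sumL-sumℤ c f ys))))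

  module _ {B K : Set} (_≟_ : DecidableEquality K) (key : B → K) where

    fibre : List B → K → List B
    fibre zs y = filter (λ z → key z ≟ y) zs

    sum-δ-out : ∀ {ys} k → All (k ≢_) ys → sumL (λ y → ⟦ k ≟ y ⟧) ys ≡ 0ℤ
    sum-δ-out k [] = refl
    sum-δ-out k (k≢y ∷ k∉) = cong₂ _+_ (⟦⟧-false (k ≟ _) k≢y) (sum-δ-out k k∉)

    sum-δ : ∀ {ys k} → Unique ys → k ∈ ys → sumL (λ y → ⟦ k ≟ y ⟧) ys ≡ 1ℤ
    sum-δ {k = k} (k∉ ∷ _) (here refl) = cong₂ _+_ (⟦⟧-true (k ≟ _) refl) (sum-δ-out k k∉)
    sum-δ {k = k} (y∉ ∷ u) (there i) =
      cong₂ _+_ (⟦⟧-false (k ≟ _) λ { refl → All.lookup y∉ i refl }) (sum-δ u i)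

    length-fibre-∷ : ∀ z zs y → ℤ.+ length (fibre (z ∷ zs) y) ≡ ⟦ key z ≟ y ⟧ + ℤ.+ length (fibre zs y)
    length-fibre-∷ z zs y with key z ≟ y
    ... | yes _ = refl
    ... | no _  = sym (ℤ.+-identityˡ _)

    length-by-fibres : ∀ {ys} → Unique ys → ∀ zs → (∀ {z} → z ∈ zs → key z ∈ ys) →
      ℤ.+ length zs ≡ sumL (λ y → ℤ.+ length (fibre zs y)) ys
    length-by-fibres {ys} u [] _ = sym (sumL-0 ys)
    length-by-fibres {ys} u (z ∷ zs) k∈ = sym (trans (sumL-cong {ys = ys} λ {y} _ → length-fibre-∷ z zs y)
      (trans (sumL-+ (λ y → ⟦ key z ≟ y ⟧) (λ y → ℤ.+ length (fibre zs y)) ys)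
        (cong₂ _+_ (sum-δ u (k∈ (here refl))) (sym (length-by-fibres u zs (k∈ ∘ there))))))

  length-subsingleton : {B Q : Set} {P : B → Set} (P? : Decidable P) (Q? : Dec Q) {zs : List B} → Unique zs →
    (∀ {z z′} → z ∈ zs → z′ ∈ zs → P z → P z′ → z ≡ z′) →
    (Q → ∃[ z ] (z ∈ zs × P z)) → (∀ {z} → z ∈ zs → P z → Q) →
    ℤ.+ length (filter P? zs) ≡ ⟦ Q? ⟧
  length-subsingleton P? Q? {zs} u single Q⇒ ⇒Q with filter P? zs in eq
  ... | [] = sym (⟦⟧-false Q? ¬Q)
    where
    ¬Q : ¬ _
    ¬Q q with z , i , p ← Q⇒ q with () ← subst (z ∈_) eq (∈-filter⁺ P? i p)
  ... | z ∷ [] = sym (⟦⟧-true Q? (⇒Q (proj₁ in-zs) (proj₂ in-zs)))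
    where
    in-zs : z ∈ zs × _
    in-zs = ∈-filter⁻ P? (subst (z ∈_) (sym eq) (here refl))
  ... | z ∷ z′ ∷ l = contradiction (single i i′ p p′) z≢z′
    where
    z∈ : z ∈ zs × _
    z∈ = ∈-filter⁻ P? (subst (z ∈_) (sym eq) (here refl))
    z′∈ : z′ ∈ zs × _
    z′∈ = ∈-filter⁻ P? (subst (z′ ∈_) (sym eq) (there (here refl)))
    i = proj₁ z∈
    p = proj₂ z∈
    i′ = proj₁ z′∈
    p′ = proj₂ z′∈
    z≢z′ : z ≢ z′
    z≢z′ with (z∉ ∷ _) ← subst Unique eq (Unique.filter⁺ P? u) = All.head z∉

  length-split : {B : Set} {P P₁ P₂ : B → Set} (P? : Decidable P) (P₁? : Decidable P₁) (P₂? : Decidable P₂) →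
    ∀ zs → (∀ {z} → z ∈ zs → P z → P₁ z ⊎ P₂ z) → (∀ {z} → P₁ z → P z) → (∀ {z} → P₂ z → P z) →
    (∀ {z} → z ∈ zs → P₁ z → ¬ P₂ z) →
    ℤ.+ length (filter P? zs) ≡ ℤ.+ length (filter P₁? zs) + ℤ.+ length (filter P₂? zs)
  length-split P? P₁? P₂? [] _ _ _ _ = refl
  length-split P? P₁? P₂? (z ∷ zs) split i₁ i₂ disj
    with P? z | P₁? z | P₂? z | length-split P? P₁? P₂? zs (split ∘ there) i₁ i₂ (disj ∘ there)
  ... | yes p | no ¬p₁ | no ¬p₂ | _ = contradiction (split (here refl) p) λ { (inj₁ p₁) → ¬p₁ p₁ ; (inj₂ p₂) → ¬p₂ p₂ }
  ... | _     | yes p₁ | yes p₂ | _ = contradiction p₂ (disj (here refl) p₁)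
  ... | no ¬p | yes p₁ | no _   | _ = contradiction (i₁ p₁) ¬p
  ... | no ¬p | no _   | yes p₂ | _ = contradiction (i₂ p₂) ¬p
  ... | no _  | no _   | no _   | ih = ih
  ... | yes _ | yes _  | no _   | ih = trans (cong (1ℤ +_) ih)
    (sym (ℤ.+-assoc 1ℤ (ℤ.+ length (filter P₁? zs)) (ℤ.+ length (filter P₂? zs))))
  ... | yes _ | no _   | yes _  | ih = trans (cong (1ℤ +_) ih)
    (solve 3 (λ o a b → o :+ (a :+ b) := a :+ (o :+ b)) refl 1ℤ (ℤ.+ length (filter P₁? zs)) (ℤ.+ length (filter P₂? zs)))

open Sums

-- The Möbius function of the flats

record FlatPoset (Ar : Arrangement) (m : ℕ) : Set where
  open Arrangement Ar
  field
    rep : Fin m → List H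
    rep-real : ∀ a → Real (on (rep a))
    rep-antisym : ∀ {a b} → rep a ⊑ rep b → rep b ⊑ rep a → a ≡ b
    rep-cover : ∀ R → Real (on R) → ∃[ a ] (R ⊑ rep a × rep a ⊑ R)
    -- Reverse inclusion: the smaller element `b` has the larger region, hence `rep a ⊑ rep b`.
    lt : Fin m → Fin m → Bool
    lt⇒ : ∀ {b a} → lt b a ≡ true → b ≢ a × rep a ⊑ rep b
    ⇒lt : ∀ {b a} → b ≢ a → rep a ⊑ rep b → lt b a ≡ true
    bot : Fin m
    bot-full : [] ⊑ rep bot

module Moebius (Ar : Arrangement) (dec : ∀ cs → Dec (Arrangement.Real Ar cs)) {m : ℕ} (F : FlatPoset Ar m)
  (A : List (Arrangement.H Ar)) (A-complete : ∀ h → h ∈ A) (A-proper : ∀ h → Arrangement.Proper Ar [] h) where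
  open import Data.Integer using (_+_; _*_; -_)
  open ℤ-Solver.+-*-Solver using (solve; _:+_; _:*_; :-_; _:-_; con; _:=_)

  open Arrangement Ar
  open Regions Ar dec
  open FlatPoset F

  indicator : ∀ R → Dec (Real (on R)) → Fin m → ℤ
  indicator R (yes real) b = ⟦ rep-cover R real .proj₁ Fin.≟ b ⟧
  indicator R (no _)     b = 0ℤ

  -- 1 if the flat of `R` is u_b. It is 0 for every `b` when ⋂R misses `C`, which removes such lists
  -- from all the sums.
  χ : List H → Fin m → ℤ
  χ R = indicator R (dec (on R))

  χ-cong : ∀ {R R′} → R ⊑ R′ → R′ ⊑ R → ∀ b → χ R b ≡ χ R′ b
  χ-cong {R} {R′} ⊑₁ ⊑₂ b with dec (on R) | dec (on R′)
  ... | no _  | no _ = refl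
  ... | yes r | no ¬r = contradiction (Real-≼ ⊑₁ r) ¬r
  ... | no ¬r | yes r = contradiction (Real-≼ ⊑₂ r) ¬r
  ... | yes r | yes r′ with rep-cover R r | rep-cover R′ r′
  ...   | a , i , j | a′ , i′ , j′ = cong (λ a → ⟦ a Fin.≟ b ⟧)
    (rep-antisym (λ x Cx → i′ x Cx ∘ ⊑₁ x Cx ∘ j x Cx) (λ x Cx → i x Cx ∘ ⊑₂ x Cx ∘ j′ x Cx))

  χ-nonNeg : ∀ R b → 0ℤ ℤ.≤ χ R b
  χ-nonNeg R b with dec (on R)
  ... | no _ = ℤ.≤-refl
  ... | yes r with rep-cover R r .proj₁ Fin.≟ b
  ...   | yes _ = ℤ.+≤+ ℕ.z≤n
  ...   | no _  = ℤ.≤-refl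

  χ-parity : ∀ R b → χ R b * parity R ≡ parity (rep b) * χ R b
  χ-parity R b with dec (on R)
  ... | no _ = sym (ℤ.*-zeroʳ (parity (rep b)))
  ... | yes r with rep-cover R r
  ...   | a , i , j with a Fin.≟ b
  ...     | no _     = sym (ℤ.*-zeroʳ (parity (rep b)))
  ...     | yes refl = trans (ℤ.*-identityˡ (parity R)) (trans (parity-cong r i j) (sym (ℤ.*-identityʳ (parity (rep a)))))

  sum-χ : ∀ (g : Fin m → ℤ) {R} → (∃[ a ] (Real (on R) × R ⊑ rep a × rep a ⊑ R × sumℤ (λ b → g b * χ R b) ≡ g a))
                    ⊎ (¬ Real (on R) × sumℤ (λ b → g b * χ R b) ≡ 0ℤ)
  sum-χ g {R} with dec (on R)
  ... | no ¬r = inj₂ (¬r , sumℤ-zero λ b → ℤ.*-zeroʳ (g b))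
  ... | yes r = inj₁ (rep-cover R r .proj₁ , r , rep-cover R r .proj₂ .proj₁ , rep-cover R r .proj₂ .proj₂ ,
                      sumℤ-δ g (rep-cover R r .proj₁))

  sum-tree : ∀ τ (g : Fin m → ℤ) R B →
    sumℤ (λ b → g b * tree τ (λ R → χ R b) R B) ≡ tree τ (λ R → sumℤ (λ b → g b * χ R b)) R B
  sum-tree τ g R [] = refl
  sum-tree τ g R (h ∷ B) = trans
    (sumℤ-cong λ b → solve 4 (λ g x s y → g :* (x :+ s :* y) := g :* x :+ s :* (g :* y)) refl
      (g b) (tree τ (λ R → χ R b) R B) (τ R h) (tree τ (λ R → χ R b) (h ∷ R) B))
    (trans (sumℤ-linear (λ b → g b * tree τ (λ R → χ R b) R B) (λ b → g b * tree τ (λ R → χ R b) (h ∷ R) B) (τ R h))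
      (cong₂ (λ x y → x + τ R h * y) (sum-tree τ g R B) (sum-tree τ g (h ∷ R) B)))

  -- Whitney's formula: the sum of (-1)^|S| over the sublists S of A with ⋂ S = u_b.
  whitney : Fin m → ℤ
  whitney b = tree (λ _ _ → -1ℤ) (λ R → χ R b) [] A

  weight : Fin m → List H → List H → ℤ
  weight b = tree σ (λ R → χ R b)

  weight-cong : ∀ b {R R′} → R ⊑ R′ → R′ ⊑ R → ∀ B → weight b R B ≡ weight b R′ B
  weight-cong b i j [] = χ-cong i j b
  weight-cong b i j (h ∷ B) = cong₂ _+_ (weight-cong b i j B)
    (cong₂ _*_ (σ-cong h i j) (weight-cong b (≼-∷ i) (≼-∷ j) B))

  -- A proper `h` adds two nonnegative branches; an improper one gives two branches over the same
  -- flat, which cancel.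
  weight-nonNeg : ∀ b R B → 0ℤ ℤ.≤ weight b R B
  weight-nonNeg b R [] = χ-nonNeg R b
  weight-nonNeg b R (h ∷ B) with proper? R h
  ... | yes _ = ℤ.+-mono-≤ (weight-nonNeg b R B)
    (subst (0ℤ ℤ.≤_) (sym (ℤ.*-identityˡ _)) (weight-nonNeg b (h ∷ R) B))
  ... | no ¬pr = ℤ.≤-reflexive (sym (trans
    (cong (λ z → z + -1ℤ * weight b (h ∷ R) B) (weight-cong b (¬Proper⇒⊑ ¬pr) (λ { x Cx (_ ∷ Sx) → Sx }) B))
    (solve 1 (λ x → x :+ con -1ℤ :* x := con 0ℤ) refl (weight b (h ∷ R) B))))

  -- Each step down the tree turns `σ` into -1, because `parity (h ∷ R)` is - `σ R h` times
  -- `parity R`. At the leaves counted by `χ` the remaining parity is that of u_b, whichever sublist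
  -- led there.
  weight-parity : ∀ b R B →
    weight b R B * parity R ≡ parity (rep b) * tree (λ _ _ → -1ℤ) (λ R → χ R b) R B
  weight-parity b R [] = χ-parity R b
  weight-parity b R (h ∷ B) = trans
    (solve 4 (λ x s y p → (x :+ s :* y) :* p := x :* p :+ con -1ℤ :* (y :* (:- (s :* p)))) refl
      (weight b R B) (σ R h) (weight b (h ∷ R) B) (parity R))
    (trans (cong₂ (λ x y → x + -1ℤ * y) (weight-parity b R B) (weight-parity b (h ∷ R) B))
      (solve 3 (λ e x y → e :* x :+ con -1ℤ :* (e :* y) := e :* (x :+ con -1ℤ :* y)) refl
        (parity (rep b)) (tree (λ _ _ → -1ℤ) (λ R → χ R b) R B) (tree (λ _ _ → -1ℤ) (λ R → χ R b) (h ∷ R) B)))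

  ∣sgn∣ : {P : Set} (P? : Dec P) → ℤ.∣ sgn P? ∣ ≡ 1
  ∣sgn∣ (yes _) = refl
  ∣sgn∣ (no _)  = refl

  ∣parity∣ : ∀ R → ℤ.∣ parity R ∣ ≡ 1
  ∣parity∣ [] = refl
  ∣parity∣ (h ∷ R) = trans (ℤ.∣-i∣≡∣i∣ (σ R h * parity R))
    (trans (ℤ.abs-* (σ R h) (parity R)) (cong₂ ℕ._*_ (∣sgn∣ (proper? R h)) (∣parity∣ R)))

  ∣whitney∣ : ∀ b → ℤ.+ ℤ.∣ whitney b ∣ ≡ weight b [] A
  ∣whitney∣ b = trans (cong ℤ.+_ (begin
    ℤ.∣ whitney b ∣                                   ≡⟨ sym (ℕ.+-identityʳ _) ⟩
    1 ℕ.* ℤ.∣ whitney b ∣                      ≡⟨ cong (ℕ._* ℤ.∣ whitney b ∣) (sym (∣parity∣ (rep b))) ⟩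
    ℤ.∣ parity (rep b) ∣ ℕ.* ℤ.∣ whitney b ∣   ≡⟨ sym (ℤ.abs-* (parity (rep b)) (whitney b)) ⟩
    ℤ.∣ parity (rep b) * whitney b ∣                  ≡⟨ cong ℤ.∣_∣ (sym (weight-parity b [] A)) ⟩
    ℤ.∣ weight b [] A * 1ℤ ∣                          ≡⟨ cong ℤ.∣_∣ (ℤ.*-identityʳ (weight b [] A)) ⟩
    ℤ.∣ weight b [] A ∣                               ∎)) (ℤ.0≤i⇒+∣i∣≡i (weight-nonNeg b [] A))
    where
    open ≡-Reasoning

  All⇒Sat : ∀ {R x} → All (λ h → φ h x ≡ 0ℚ) R → Sat (on R) x
  All⇒Sat = All.map⁺

  Sat⇒All : ∀ {R x} → Sat (on R) x → All (λ h → φ h x ≡ 0ℚ) R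
  Sat⇒All = All.map⁻

  lies? : ∀ x h → Dec (φ h x ≡ 0ℚ)
  lies? x h = φ h x ℚ.≟ 0ℚ

  inFlat? : ∀ x R → Dec (All (λ h → φ h x ≡ 0ℚ) R)
  inFlat? x = all? (lies? x)

  -- After exchanging the sums, the leaf `R` contributes 1 exactly if `R` is realizable and all its
  -- hyperplanes pass through x. Only the hyperplanes through x survive, and the tree of these
  -- counts their regions in `C`. As x is only in `S`, membership in flats is transferred by
  -- `Flat-⊑`.
  sum-weight : ∀ x → S x → sumℤ (λ b → ⟦ inFlat? x (rep b) ⟧ * weight b [] A) ≡ regions [] (filter (lies? x) A)
  sum-weight x x∈S = begin
    sumℤ (λ b → g b * weight b [] A)                     ≡⟨ sum-tree σ g [] A ⟩
    tree σ β [] A                                        ≡⟨ tree-filter (lies? x) {σ} β-zero [] A ⟩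
    tree σ β [] (filter (lies? x) A)                     ≡⟨ tree-cong {σ = σ} β-real [] (All.all-filter (lies? x) A) ⟩
    tree σ (λ R → ⟦ dec (on R) ⟧) [] (filter (lies? x) A) ≡⟨ sym (regions≡tree [] (filter (lies? x) A)) ⟩
    regions [] (filter (lies? x) A)                      ∎
    where
    open ≡-Reasoning
    g : Fin m → ℤ
    g b = ⟦ inFlat? x (rep b) ⟧
    β : List H → ℤ
    β R = sumℤ (λ b → g b * χ R b)
    β-zero : ∀ {R} → ¬ All (λ h → φ h x ≡ 0ℚ) R → β R ≡ 0ℤ
    β-zero {R} ¬all with sum-χ g {R}
    ... | inj₂ (_ , eq) = eq
    ... | inj₁ (a , _ , i , j , eq) = trans eq (⟦⟧-false (inFlat? x (rep a))
      λ all → ¬all (Sat⇒All (Flat-⊑ (rep-real a) j x∈S (All⇒Sat all))))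
    β-real : ∀ {R} → All (λ h → φ h x ≡ 0ℚ) R → β R ≡ ⟦ dec (on R) ⟧
    β-real {R} all with sum-χ g {R}
    ... | inj₂ (¬r , eq) = trans eq (sym (⟦⟧-false (dec (on R)) ¬r))
    ... | inj₁ (a , r , i , j , eq) = trans eq (trans
      (⟦⟧-true (inFlat? x (rep a)) (Sat⇒All (Flat-⊑ r i x∈S (All⇒Sat all)))) (sym (⟦⟧-true (dec (on R)) r)))

  -- Serves two choices of `T`: the hyperplanes through a point of `C`, and those containing u_a. In
  -- both, `g` selects the flats cut out by hyperplanes in `T`, and every list from `T` is
  -- realizable, so the alternating sum runs over all sublists of the filtered list.
  sum-whitney : ∀ {T : H → Set} (T? : Decidable T) (g : Fin m → ℤ) →
    (∀ {R a} → Real (on R) → R ⊑ rep a → rep a ⊑ R → All T R → g a ≡ 1ℤ) →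
    (∀ {R a} → R ⊑ rep a → rep a ⊑ R → ¬ All T R → g a ≡ 0ℤ) →
    (∀ {R} → All T R → Real (on R)) →
    sumℤ (λ b → g b * whitney b) ≡ isEmpty (filter T? A)
  sum-whitney {T} T? g one none real = trans (sum-tree (λ _ _ → -1ℤ) g [] A)
    (trans (tree-filter T? β-zero [] A) (tree-alternating β-one [] (All.all-filter T? A)))
    where
    β : List H → ℤ
    β R = sumℤ (λ b → g b * χ R b)
    β-zero : ∀ {R} → ¬ All T R → β R ≡ 0ℤ
    β-zero {R} ¬all with sum-χ g {R}
    ... | inj₂ (_ , eq) = eq
    ... | inj₁ (a , _ , i , j , eq) = trans eq (none i j ¬all)
    β-one : ∀ {R} → All T R → β R ≡ 1ℤ
    β-one {R} all with sum-χ g {R}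
    ... | inj₂ (¬r , _) = contradiction (real all) ¬r
    ... | inj₁ (a , r , i , j , eq) = trans eq (one r i j all)

  sum-whitney-point : ∀ x → C x →
    sumℤ (λ b → ⟦ inFlat? x (rep b) ⟧ * whitney b) ≡ isEmpty (filter (lies? x) A)
  sum-whitney-point x Cx = sum-whitney (lies? x) _
    (λ {R} {a} r i j all → ⟦⟧-true (inFlat? x (rep a)) (Sat⇒All (i x Cx (All⇒Sat all))))
    (λ {R} {a} i j ¬all → ⟦⟧-false (inFlat? x (rep a)) λ all → ¬all (Sat⇒All (j x Cx (All⇒Sat all))))
    (λ all → x , Cx , All⇒Sat all)

  -- Tests whether `h` contains u_a.
  improper? : ∀ a h → Dec (¬ Proper (rep a) h)
  improper? a h = ¬? (proper? (rep a) h)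

  ⊑⇒improper : ∀ {R R′} → R ⊑ R′ → All (λ h → ¬ Proper R h) R′
  ⊑⇒improper {R′ = []} _ = []
  ⊑⇒improper {R′ = h ∷ R′} R⊑R′ = (λ (x , Cx , Sx , x∉h) → x∉h (All.head (R⊑R′ x Cx Sx))) ∷
                               ⊑⇒improper λ x Cx Sx → All.tail (R⊑R′ x Cx Sx)

  improper⇒⊑ : ∀ {R R′} → All (λ h → ¬ Proper R h) R′ → R ⊑ R′
  improper⇒⊑ [] x Cx Sx = []
  improper⇒⊑ (¬pr ∷ ps) x Cx Sx = ¬Proper⇒φ≡0 ¬pr Cx Sx ∷ improper⇒⊑ ps x Cx Sx

  sum-whitney-below : ∀ a →
    sumℤ (λ b → ⟦ all? (improper? a) (rep b) ⟧ * whitney b) ≡ isEmpty (filter (improper? a) A)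
  sum-whitney-below a = sum-whitney (improper? a) _
    (λ {R} {b} r i j all → ⟦⟧-true (all? (improper? a) (rep b)) (⊑⇒improper λ x Cx → i x Cx ∘ improper⇒⊑ all x Cx))
    (λ {R} {b} i j ¬all → ⟦⟧-false (all? (improper? a) (rep b))
      λ all → ¬all (⊑⇒improper λ x Cx → j x Cx ∘ improper⇒⊑ all x Cx))
    (λ all → Real-≼ (improper⇒⊑ all) (rep-real a))

  isEmpty-∈ : ∀ {h : H} {B} → h ∈ B → isEmpty B ≡ 0ℤ
  isEmpty-∈ (here _)  = refl
  isEmpty-∈ (there _) = refl

  below : (Fin m → ℤ) → Fin m → ℤ
  below f a = sumℤ (λ b → if lt b a then f b else 0ℤ)

  -- The flats containing u_a are u_a itself and those strictly below it in the poset.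
  whitney-split : ∀ a → whitney a + below whitney a ≡ isEmpty (filter (improper? a) A)
  whitney-split a = trans (sym (trans (sumℤ-cong pointwise)
    (trans (sumℤ-+ (λ b → whitney b * ⟦ a Fin.≟ b ⟧) (λ b → if lt b a then whitney b else 0ℤ))
      (cong (λ z → z + below whitney a) (sumℤ-δ whitney a))))) (sum-whitney-below a)
    where
    pointwise : ∀ b → ⟦ all? (improper? a) (rep b) ⟧ * whitney b ≡
                      whitney b * ⟦ a Fin.≟ b ⟧ + (if lt b a then whitney b else 0ℤ)
    pointwise b with a Fin.≟ b | lt b a in eq
    ... | yes refl | true  = contradiction refl (lt⇒ eq .proj₁)
    ... | yes refl | false = trans (cong (λ z → z * whitney b)
        (⟦⟧-true (all? (improper? a) (rep b)) (⊑⇒improper {rep a} λ x Cx → id)))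
      (solve 1 (λ x → con 1ℤ :* x := x :* con 1ℤ :+ con 0ℤ) refl (whitney b))
    ... | no _ | true = trans (cong (λ z → z * whitney b)
        (⟦⟧-true (all? (improper? a) (rep b)) (⊑⇒improper (lt⇒ eq .proj₂))))
      (solve 1 (λ x → con 1ℤ :* x := x :* con 0ℤ :+ x) refl (whitney b))
    ... | no a≢b | false = trans (cong (λ z → z * whitney b) (⟦⟧-false (all? (improper? a) (rep b)) ¬all))
      (solve 1 (λ x → con 0ℤ :* x := x :* con 0ℤ :+ con 0ℤ) refl (whitney b))
      where
      ¬all : ¬ All (λ h → ¬ Proper (rep a) h) (rep b)
      ¬all all with () ← trans (sym eq) (⇒lt (a≢b ∘ sym) (improper⇒⊑ all))

  ¬lt-bot : ∀ b → lt b bot ≡ false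
  ¬lt-bot b with lt b bot in eq
  ... | false = refl
  ... | true with b≢bot , i ← lt⇒ eq = contradiction (rep-antisym (λ x Cx _ → bot-full x Cx []) i) b≢bot

  whitney-bot : whitney bot ≡ 1ℤ
  whitney-bot = begin
    whitney bot                             ≡⟨ sym (ℤ.+-identityʳ _) ⟩
    whitney bot + 0ℤ                        ≡⟨ cong (λ z → whitney bot + z) (sym below≡0) ⟩
    whitney bot + below whitney bot         ≡⟨ whitney-split bot ⟩
    isEmpty (filter (improper? bot) A)      ≡⟨ cong isEmpty (List.filter-none (improper? bot) (All.universal proper A)) ⟩
    1ℤ                                      ∎
    where
    open ≡-Reasoning
    below≡0 : below whitney bot ≡ 0ℤ
    below≡0 = sumℤ-zero λ b → cong (λ l → if l then whitney b else 0ℤ) (¬lt-bot b)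
    proper : ∀ h → ¬ ¬ Proper (rep bot) h
    proper h ¬pr = ¬pr (Proper-⊑ bot-full (A-proper h))

  -- A flat other than the bottom has a nonempty representing list, so some hyperplane contains it
  -- and the alternating sum over the hyperplanes containing it vanishes.
  whitney-rec : ∀ a → a ≢ bot → whitney a ≡ - below whitney a
  whitney-rec a a≢bot = begin
    whitney a
      ≡⟨ solve 2 (λ x y → x := x :+ y :- y) refl (whitney a) (below whitney a) ⟩
    whitney a + below whitney a + - below whitney a
      ≡⟨ cong (λ z → z + - below whitney a) (trans (whitney-split a) (nonempty (rep a) refl)) ⟩
    0ℤ + - below whitney a
      ≡⟨ ℤ.+-identityˡ _ ⟩
    - below whitney a ∎
    where
    open ≡-Reasoning
    nonempty : ∀ R → rep a ≡ R → isEmpty (filter (improper? a) A) ≡ 0ℤ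
    nonempty [] eq = contradiction
      (rep-antisym (λ x Cx _ → bot-full x Cx []) (λ x Cx _ → subst (λ R → Sat (on R) x) (sym eq) [])) a≢bot
    nonempty (h ∷ R) eq = isEmpty-∈ (∈-filter⁺ (improper? a) (A-complete h)
      (All.head (⊑⇒improper {rep a} {h ∷ R} λ x Cx → subst (λ R → Sat (on R) x) eq)))

  lt-isStrictPartialOrder : IsStrictPartialOrder _≡_ (λ b a → lt b a ≡ true)
  lt-isStrictPartialOrder = record
    { isEquivalence = isEquivalence
    ; irrefl = λ { refl l → lt⇒ l .proj₁ refl }
    ; trans = λ {c} {b} {a} → ltrans c b a
    ; <-resp-≈ = (λ { refl → id }) , (λ { refl → id })
    }
    where
    ltrans : ∀ c b a → lt c b ≡ true → lt b a ≡ true → lt c a ≡ true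
    ltrans c b a l l′ with c≢b , i ← lt⇒ l | b≢a , j ← lt⇒ l′ =
      ⇒lt (λ { refl → c≢b (rep-antisym j i) }) (λ x Cx → i x Cx ∘ j x Cx)

  moebius-unique : ∀ (mu : Fin m → ℤ) → mu bot ≡ 1ℤ → (∀ a → a ≢ bot → mu a ≡ - below mu a) →
    ∀ a → mu a ≡ whitney a
  moebius-unique mu mu-bot mu-rec a = go a (spo-wellFounded lt-isStrictPartialOrder a)
    where
    go : ∀ a → Acc (λ b a → lt b a ≡ true) a → mu a ≡ whitney a
    go a (acc rs) with a Fin.≟ bot
    ... | yes refl  = trans mu-bot (sym whitney-bot)
    ... | no a≢bot = trans (mu-rec a a≢bot) (trans (cong -_ (sumℤ-cong pointwise)) (sym (whitney-rec a a≢bot)))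
      where
      pointwise : ∀ b → (if lt b a then mu b else 0ℤ) ≡ (if lt b a then whitney b else 0ℤ)
      pointwise b with lt b a in eq
      ... | true  = go b (rs eq)
      ... | false = refl

-- Decidability under double negation

module _ {E : Set} where

  select : (E → Bool) → List E → List E → List E
  select p []      seed = seed
  select p (e ∷ l) seed = select p l (if p e then e ∷ seed else seed)

  select-seed : ∀ p l {seed e} → e ∈ seed → e ∈ select p l seed
  select-seed p []      i = i
  select-seed p (x ∷ l) i with p x
  ... | true  = select-seed p l (there i)
  ... | false = select-seed p l i

  select⁺ : ∀ p {l seed e} → e ∈ l → p e ≡ true → e ∈ select p l seed
  select⁺ p {x ∷ l} (here refl) eq rewrite eq = select-seed p l (here refl)
  select⁺ p {x ∷ l} (there i)   eq = select⁺ p i eq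

  select⁻ : ∀ p l {seed e} → e ∈ select p l seed → e ∈ seed ⊎ p e ≡ true
  select⁻ p []      i = inj₁ i
  select⁻ p (x ∷ l) i with p x in eq
  ... | false = select⁻ p l i
  ... | true with select⁻ p l i
  ...   | inj₁ (here refl) = inj₂ eq
  ...   | inj₁ (there j)   = inj₁ j
  ...   | inj₂ pe          = inj₂ pe

  -- Quantifying over all p would not commute with double negation, but `select` has at most 2^|l|
  -- results. Branching on each element being kept or dropped reaches them all, with one use of
  -- excluded middle at each leaf.
  ¬¬-dec-select : (P : List E → Set) → ∀ l seed → ¬ ¬ (∀ p → Dec (P (select p l seed)))
  ¬¬-dec-select P []      seed k = ¬¬-excluded-middle λ d → k λ p → d
  ¬¬-dec-select P (e ∷ l) seed k =
    ¬¬-dec-select P l (e ∷ seed) λ d₁ → ¬¬-dec-select P l seed λ d₀ → k (merge d₁ d₀)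
    where
    merge : (∀ p → Dec (P (select p l (e ∷ seed)))) → (∀ p → Dec (P (select p l seed))) →
            ∀ p → Dec (P (select p l (if p e then e ∷ seed else seed)))
    merge d₁ d₀ p with p e
    ... | true  = d₁ p
    ... | false = d₀ p

  -- A predicate of lists that depends only on the underlying set has finitely many
  -- instances over a finite type, so it may be assumed decidable in proving a stable goal.
  ¬¬-dec-antitone : DecidableEquality E → ∀ {enum} → (∀ e → e ∈ enum) →
    (P : List E → Set) → (∀ {xs ys} → xs ⊆ ys → P ys → P xs) → ¬ ¬ (∀ xs → Dec (P xs))
  -- `xs` is replaced by the elements of `enum` that occur in it; the two lists contain each other,
  -- so antitonicity transfers the decision both ways.
  ¬¬-dec-antitone _≟_ {enum} complete P antitone k = ¬¬-dec-select P enum [] λ d → k λ xs →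
    map′ (antitone (⊆sel xs)) (antitone (sel⊆ xs)) (d (λ e → does (e ∈? xs)))
    where
    open DecMembership _≟_ using (_∈?_)
    ⊆sel : ∀ xs → xs ⊆ select (λ e → does (e ∈? xs)) enum []
    ⊆sel xs {e} i = select⁺ _ (complete e) (true! (e ∈? xs))
      where
      true! : (d : Dec (e ∈ xs)) → does d ≡ true
      true! (yes _) = refl
      true! (no ¬i) = contradiction i ¬i
    sel⊆ : ∀ xs → select (λ e → does (e ∈? xs)) enum [] ⊆ xs
    sel⊆ xs {e} i with select⁻ (λ e → does (e ∈? xs)) enum i
    ... | inj₂ eq with e ∈? xs
    ...   | yes j = j

sign-≟ : DecidableEquality Sign
sign-≟ null null = yes refl
sign-≟ null pos  = no λ ()
sign-≟ null neg  = no λ ()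
sign-≟ pos  null = no λ ()
sign-≟ pos  pos  = yes refl
sign-≟ pos  neg  = no λ ()
sign-≟ neg  null = no λ ()
sign-≟ neg  pos  = no λ ()
sign-≟ neg  neg  = yes refl

signs : List Sign
signs = null ∷ pos ∷ neg ∷ []

∈-signs : ∀ c → c ∈ signs
∈-signs null = here refl
∈-signs pos  = there (here refl)
∈-signs neg  = there (there (here refl))

lookup-ext : ∀ {A : Set} {n} {u v : Vec A n} → (∀ j → Vec.lookup u j ≡ Vec.lookup v j) → u ≡ v
lookup-ext {u = u} {v} eq =
  trans (sym (Vec.tabulate∘lookup u)) (trans (Vec.tabulate-cong eq) (Vec.tabulate∘lookup v))

bool-ext : ∀ {a b} → (a ≡ true → b ≡ true) → (b ≡ true → a ≡ true) → a ≡ b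
bool-ext {true}  {b}     f g = sym (f refl)
bool-ext {false} {true}  f g = g refl
bool-ext {false} {false} f g = refl

xor-trueˡ : ∀ {a b} → (a xor b) ≡ true → a ≡ true → b ≡ false
xor-trueˡ {true} {false} _ _ = refl

xor-falseˡ : ∀ {a b} → (a xor b) ≡ true → a ≡ false → b ≡ true
xor-falseˡ {false} {true} _ _ = refl

does⇒ : {P : Set} (P? : Dec P) → does P? ≡ true → P
does⇒ (yes p) _ = p

-- The hyperplanes of collinear pairs in s

module Geometry {d n : ℕ} (L : Fin n → Subset d) where
  open import Data.Rational using (_+_; _*_; _-_; -_; _<_; _≤_; ∣_∣)
  open import Data.Rational.Properties

  lineSum-cong : ∀ i {x y : Point L} → (∀ j → x j ≡ y j) → lineSumℚ L i x ≡ lineSumℚ L i y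
  lineSum-cong i eq = sumℚ-cong λ j → cong (λ z → if Vec.lookup (L i) j then z else 0ℚ) (eq j)

  lineSum-lin : ∀ i (x y : Point L) s →
    lineSumℚ L i (λ j → x j + s * (y j - x j)) ≡ lineSumℚ L i x + s * (lineSumℚ L i y - lineSumℚ L i x)
  lineSum-lin i x y s = trans (sumℚ-cong pointwise) 
    (sumℚ-lin (λ j → if Vec.lookup (L i) j then x j else 0ℚ) (λ j → if Vec.lookup (L i) j then y j else 0ℚ) s)
    where
    pointwise : ∀ j → (if Vec.lookup (L i) j then x j + s * (y j - x j) else 0ℚ) ≡
      (if Vec.lookup (L i) j then x j else 0ℚ) +
      s * ((if Vec.lookup (L i) j then y j else 0ℚ) - (if Vec.lookup (L i) j then x j else 0ℚ))
    pointwise j with Vec.lookup (L i) j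
    ... | true  = refl
    ... | false = sym (lin-same 0ℚ s)

  lineSum-scale : ∀ i c (f : Fin d → ℕ) →
    lineSumℚ L i (λ j → c * ι (ℤ.+ f j)) ≡ c * ι (ℤ.+ lineSumℕ L i f)
  lineSum-scale i c f = trans (sumℚ-cong pointwise) (sumℚ-scale c (λ j → if Vec.lookup (L i) j then f j else 0))
    where
    pointwise : ∀ j → (if Vec.lookup (L i) j then c * ι (ℤ.+ f j) else 0ℚ) ≡
      c * ι (ℤ.+ (if Vec.lookup (L i) j then f j else 0))
    pointwise j with Vec.lookup (L i) j
    ... | true  = refl
    ... | false = sym (trans (cong (c *_) ι-0) (*-zeroʳ c))

  f≤lineSum : ∀ {i j} (f : Fin d → ℕ) → j ∈ˢ L i → f j ℕ.≤ lineSumℕ L i f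
  f≤lineSum {i} {j} f j∈ = subst (ℕ._≤ lineSumℕ L i f)
    (cong (λ b → if b then f j else 0) (Vec.[]=⇒lookup j∈)) (f≤sumℕ (λ j → if Vec.lookup (L i) j then f j else 0) j)

  line : Point L → Point L → ℚ → Point L
  line x y s j = x j + s * (y j - x j)

  InS-line : ∀ {x y} s → InS L x → InS L y → InS L (line x y s)
  InS-line {x} {y} s x∈ y∈ i = trans (lineSum-lin i x y s)
    (trans (cong₂ (λ a b → a + s * (b - a)) (x∈ i) (y∈ i)) (lin-same 1ℚ s))

  edge? : ∀ j k → Dec (Edge L j k)
  edge? j k = ¬? (j Fin.≟ k) ×-dec Fin.any? (λ i → (j ∈ˢ? L i) ×-dec (k ∈ˢ? L i))

  Edge-sym : ∀ {j k} → Edge L j k → Edge L k j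
  Edge-sym (j≢k , i , j∈ , k∈) = j≢k ∘ sym , i , k∈ , j∈

  edges : List (Fin d × Fin d)
  edges = filter (λ jk → edge? (proj₁ jk) (proj₂ jk)) (cartesianProduct (allFin d) (allFin d))

  Hyp : Set
  Hyp = Fin (length edges)

  src tgt : Hyp → Fin d
  src h = proj₁ (List.lookup edges h)
  tgt h = proj₂ (List.lookup edges h)

  isEdge : ∀ h → Edge L (src h) (tgt h)
  isEdge h = proj₂ (∈-filter⁻ (λ jk → edge? (proj₁ jk) (proj₂ jk))
    {xs = cartesianProduct (allFin d) (allFin d)} (∈-lookup h))

  hyp : ∀ {j k} → Edge L j k → ∃[ h ] (List.lookup edges h ≡ (j , k))
  hyp {j} {k} e = index i , sym (lookup-index i)
    where
    i : (j , k) ∈ edges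
    i = ∈-filter⁺ _ (∈-cartesianProduct⁺ (∈-allFin j) (∈-allFin k)) e

  abstract
    -- The sign is chosen so that positive values correspond to the arrow from `src h` to `tgt h`.
    gap : Hyp → Point L → ℚ
    gap h x = x (tgt h) - x (src h)

    gap-line : ∀ h x y s → gap h (line x y s) ≡ gap h x + s * (gap h y - gap h x)
    gap-line h x y s = lin-diff (x (tgt h)) (y (tgt h)) (x (src h)) (y (src h)) s

    gap≡0⇒≡ : ∀ {h x} → gap h x ≡ 0ℚ → x (src h) ≡ x (tgt h)
    gap≡0⇒≡ = q-p≡0⇒p≡q

    ≡⇒gap≡0 : ∀ {h x} → x (src h) ≡ x (tgt h) → gap h x ≡ 0ℚ
    ≡⇒gap≡0 = p≡q⇒q-p≡0

    0<gap⇒< : ∀ {h x} → 0ℚ < gap h x → x (src h) < x (tgt h)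
    0<gap⇒< = 0<q-p⇒p<q

    <⇒0<gap : ∀ {h x} → x (src h) < x (tgt h) → 0ℚ < gap h x
    <⇒0<gap = p<q⇒0<q-p

    gap<0⇒> : ∀ {h x} → gap h x < 0ℚ → x (tgt h) < x (src h)
    gap<0⇒> = p-q<0⇒p<q

    >⇒gap<0 : ∀ {h x} → x (tgt h) < x (src h) → gap h x < 0ℚ
    >⇒gap<0 = p<q⇒p-q<0

  -- `C` is taken as the positive points of s rather than through `RelInt`: its openness then comes
  -- from finitely many strict inequalities. `C⇒InP°` and `InP°⇒C` identify it with P°.
  arrangement : Arrangement
  arrangement = record
    { Pt = Point L ; H = Hyp ; lin = line
    ; φ = gap
    ; φ-lin = gap-line
    ; S = InS L
    ; C = λ x → InS L x × InO° L x
    ; C⊆S = proj₁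
    ; C-convex = λ {x} {y} {s} (x∈ , 0<x) (y∈ , 0<y) 0<s s<1 → InS-line {x} {y} s x∈ y∈ ,
        λ j → lin-nonNeg-pos (<⇒≤ (0<x j)) (0<y j) 0<s s<1
    ; C-open = λ {x} {y} (x∈ , 0<x) y∈ → open-at x y x∈ 0<x y∈
    }
    where
    open-at : ∀ x y → InS L x → InO° L x → InS L y →
      ∃[ ε ] (0ℚ < ε × (∀ s → ∣ s ∣ ≤ ε → InS L (line x y s) × InO° L (line x y s)))
    open-at x y x∈ 0<x y∈ with ε , 0<ε , near ← small-perturbation-all x (λ j → y j - x j) 0<x =
      ε , 0<ε , λ s s≤ε → InS-line {x} {y} s x∈ y∈ , near s s≤ε

  open Arrangement arrangement using (C; φ; Sat; on; Real; Proper; _⊑_)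

  Sat⇒OnFlats : ∀ {R x} → Sat (on R) x → OnFlats L (List.map (List.lookup edges) R) x
  Sat⇒OnFlats {[]}    []       = []
  Sat⇒OnFlats {h ∷ R} (p ∷ ps) = gap≡0⇒≡ p ∷ Sat⇒OnFlats ps

  OnFlats⇒Sat : ∀ {R x} → OnFlats L (List.map (List.lookup edges) R) x → Sat (on R) x
  OnFlats⇒Sat {[]}    []       = []
  OnFlats⇒Sat {h ∷ R} (p ∷ ps) = ≡⇒gap≡0 p ∷ OnFlats⇒Sat ps

  hyps : ∀ {R} → All (HEdge L) R → ∃[ R′ ] (List.map (List.lookup edges) R′ ≡ R)
  hyps [] = [] , refl
  hyps ((e , _) ∷ es) with h , eq ← hyp e | R′ , eqs ← hyps es = h ∷ R′ , cong₂ _∷_ eq eqs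

  InP-cong : ∀ {x y : Point L} → (∀ j → x j ≡ y j) → InP L x → InP L y
  InP-cong eq (x∈ , 0≤x) = (λ i → trans (sym (lineSum-cong i eq)) (x∈ i)) , λ j → subst (0ℚ ≤_) (eq j) (0≤x j)

  C⇒InP° : ∀ {x} → C x → InP° L x
  C⇒InP° {x} (x∈ , 0<x) = (x∈ , λ j → <⇒≤ (0<x j)) , extend
    where
    extend : ∀ y → InP L y → ∃[ ε ] (0ℚ < ε × InP L (λ j → x j + ε * (x j - y j)))
    -- Openness is two-sided: the parameter -ε runs from x away from y.
    extend y (y∈ , _) with ε , 0<ε , near ← Arrangement.C-open arrangement {x} {y} (x∈ , 0<x) y∈ =
      ε , 0<ε , InP-cong (λ j → lin-neg (x j) ε (y j))
        (proj₁ (near (- ε) (∣-p∣≤p 0<ε)) , λ j → <⇒≤ (proj₂ (near (- ε) (∣-p∣≤p 0<ε)) j))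

  module Scaled (t : ℕ) (0<t : 0 ℕ.< t) where

    inverse : ∃[ c ] (0ℚ < c × ι (ℤ.+ t) * c ≡ 1ℚ)
    inverse = 1/-pos (ι-pos (ℤ.+<+ 0<t))

    c : ℚ
    c = proj₁ inverse

    0<c : 0ℚ < c
    0<c = proj₁ (proj₂ inverse)

    tc≡1 : ι (ℤ.+ t) * c ≡ 1ℚ
    tc≡1 = proj₂ (proj₂ inverse)

    -- The point y/t, since `c` is 1/t; integer points of the t-fold dilate of s become points of s.
    pt : (Fin d → ℤ) → Point L
    pt y j = c * ι (y j)

    InS-pt : ∀ {f : Fin d → ℕ} → (∀ i → lineSumℕ L i f ≡ t) → InS L (pt (λ j → ℤ.+ f j))
    InS-pt {f} sums i = trans (lineSum-scale i c f)
      (trans (cong (λ s → c * ι (ℤ.+ s)) (sums i)) (trans (*-comm c _) tc≡1))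

    pt-InS : ∀ {f : Fin d → ℕ} → InS L (pt (λ j → ℤ.+ f j)) → ∀ i → lineSumℕ L i f ≡ t
    pt-InS {f} f∈ i = ℤ.+-injective (ι-injective (*-cancelˡ 0<c
      (trans (sym (lineSum-scale i c f)) (trans (f∈ i) (trans (sym tc≡1) (*-comm _ c))))))

    pt-pos : ∀ {y j} → ℤ.0ℤ ℤ.< y j → 0ℚ < pt y j
    pt-pos 0<y = *-pos 0<c (ι-pos 0<y)

    pt-mono : ∀ {y : Fin d → ℤ} {j k} → y j ℤ.< y k → pt y j < pt y k
    pt-mono lt = *-monoʳ-<-pos c {{ℚ.positive 0<c}} (ι-mono-< lt)

    pt-nonNeg : ∀ {y j} → ℤ.0ℤ ℤ.≤ y j → 0ℚ ≤ pt y j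
    pt-nonNeg 0≤y = *-nonNeg (<⇒≤ 0<c) (ι-nonNeg 0≤y)

    pt-pos⁻¹ : ∀ {y j} → 0ℚ < pt y j → ℤ.0ℤ ℤ.< y j
    pt-pos⁻¹ {y} {j} h = ι-pos⁻¹ (*-cancelˡ-<-nonNeg c {{ℚ.nonNegative (<⇒≤ 0<c)}}
      (subst (_< c * ι (y j)) (sym (*-zeroʳ c)) h))

    pt-nonNeg⁻¹ : ∀ {y j} → 0ℚ ≤ pt y j → ℤ.0ℤ ℤ.≤ y j
    pt-nonNeg⁻¹ {y} {j} h = ι-nonNeg⁻¹ (*-cancelˡ-≤-pos c {{ℚ.positive 0<c}}
      (subst (_≤ c * ι (y j)) (sym (*-zeroʳ c)) h))

    pt-injective : ∀ {y : Fin d → ℤ} {j k} → pt y j ≡ pt y k → y j ≡ y k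
    pt-injective eq = ι-injective (*-cancelˡ 0<c eq)

    pt-unique : ∀ {y : Fin d → ℤ} {x : Point L} → (∀ j → (y j ℚ./ 1) ≡ (ℤ.+ t ℚ./ 1) * x j) → ∀ j → pt y j ≡ x j
    pt-unique {y} {x} eq j = trans (cong (c *_) eqι) (trans (sym (*-assoc c (ι (ℤ.+ t)) (x j)))
      (trans (cong (λ z → z * x j) (trans (*-comm c (ι (ℤ.+ t))) tc≡1)) (*-identityˡ (x j))))
      where
      eqι : ι (y j) ≡ ι (ℤ.+ t) * x j
      eqι = trans (ι≡/1 (y j)) (trans (eq j) (cong (λ z → z * x j) (sym (ι≡/1 (ℤ.+ t)))))

    pt-scaled : ∀ y j → (y j ℚ./ 1) ≡ (ℤ.+ t ℚ./ 1) * pt y j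
    pt-scaled y j = trans (sym (ι≡/1 (y j))) (trans eqι (cong (λ z → z * pt y j) (ι≡/1 (ℤ.+ t))))
      where
      eqι : ι (y j) ≡ ι (ℤ.+ t) * pt y j
      eqι = sym (trans (sym (*-assoc (ι (ℤ.+ t)) c (ι (y j))))
        (trans (cong (λ z → z * ι (y j)) tc≡1) (*-identityˡ (ι (y j)))))

  module _ (cov : CoveringClutter d n L) {t₀ : ℕ} {f₀ : Vec ℕ d} (pl : PosLatin L t₀ f₀) where

    0<t₀ : Fin d → 0 ℕ.< t₀
    0<t₀ j with i , j∈ ← CoveringClutter.covering cov j =
      subst (0 ℕ.<_) (proj₂ (proj₂ pl) i) (ℕ.<-≤-trans (proj₁ pl j) (f≤lineSum (Vec.lookup f₀) j∈))

    -- The index only witnesses d > 0, hence t₀ > 0.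
    point₀ : Fin d → Point L
    point₀ j = Scaled.pt t₀ (0<t₀ j) (λ k → ℤ.+ Vec.lookup f₀ k)

    point₀∈C : ∀ j → C (point₀ j)
    point₀∈C j = Scaled.InS-pt t₀ (0<t₀ j) (proj₂ (proj₂ pl)) ,
      λ k → Scaled.pt-pos t₀ (0<t₀ j) {λ k → ℤ.+ Vec.lookup f₀ k} (ℤ.+<+ (proj₁ pl k))

    point₀-latin : ∀ l {j k} → Edge L j k → point₀ l j ≢ point₀ l k
    point₀-latin l {j} {k} e eq = proj₁ (proj₂ pl) j k e
      (ℤ.+-injective (Scaled.pt-injective t₀ (0<t₀ l) {λ k → ℤ.+ Vec.lookup f₀ k} eq))

    -- Extend the segment from the positive point f₀/t₀ through x: if some coordinate of x were 0,
    -- it would become negative at once.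
    InP°⇒C : ∀ {x} → InP° L x → C x
    InP°⇒C {x} ((x∈ , _) , extend) = x∈ , positive
      where
      positive : InO° L x
      positive j with ε , 0<ε , _ , 0≤ ← extend (point₀ j) (proj₁ (point₀∈C j) , λ k → <⇒≤ (proj₂ (point₀∈C j) k)) =
        pos-extends⇒pos 0<ε (proj₂ (point₀∈C j) j) (0≤ j)

    Edge⇒HEdge : ∀ {j k} → Edge L j k → HEdge L (j , k)
    Edge⇒HEdge {j} e = e , point₀ j , proj₁ (point₀∈C j) , point₀-latin j e

    hyp-proper : ∀ h → Proper [] h
    hyp-proper h = point₀ (src h) , point₀∈C (src h) , [] ,
      λ eq → point₀-latin (src h) (isEdge h) (gap≡0⇒≡ eq)

-- Flats, orientations and the two counts

module LatinLabellings {d n : ℕ} (L : Fin n → Subset d) (cov : CoveringClutter d n L)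
  {t₀ : ℕ} {f₀ : Vec ℕ d} (pl : PosLatin L t₀ f₀) {m : ℕ} (Pr : Presentation L m) where
  open import Data.Rational using (_+_; _*_; _-_; -_; _<_; _≤_; ∣_∣)
  open import Data.Rational.Properties

  open Geometry L
  open Arrangement arrangement hiding (H; S)
  module Pr = Presentation Pr

  ¬¬-dec-Real : ¬ ¬ (∀ cs → Dec (Real cs))
  ¬¬-dec-Real = ¬¬-dec-antitone (Product.≡-dec Fin._≟_ sign-≟)
    {cartesianProduct (allFin (length edges)) signs}
    (λ (h , c) → ∈-cartesianProduct⁺ (∈-allFin h) (∈-signs c))
    Real λ sub (x , Cx , Sx) → x , Cx , All.anti-mono sub Sx

  pairs : List Hyp → List (Fin d × Fin d)
  pairs = List.map (List.lookup edges)

  Region⇒ : ∀ {R R′ x} → pairs R ≡ R′ → Region L R′ x → C x × Sat (on R) x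
  Region⇒ refl (x∈ , on) = InP°⇒C cov {f₀ = f₀} pl x∈ , OnFlats⇒Sat on

  ⇒Region : ∀ {R R′ x} → pairs R ≡ R′ → C x → Sat (on R) x → Region L R′ x
  ⇒Region refl Cx Sx = C⇒InP° Cx , Sat⇒OnFlats Sx

  ⊑⇒⊆ : ∀ {R R′ S S′} → pairs R ≡ R′ → pairs S ≡ S′ → R ⊑ S → ∀ x → Region L R′ x → Region L S′ x
  ⊑⇒⊆ eq eq′ R⊑S x x∈ with Cx , Sx ← Region⇒ eq x∈ = ⇒Region eq′ Cx (R⊑S x Cx Sx)

  ⊆⇒⊑ : ∀ {R R′ S S′} → pairs R ≡ R′ → pairs S ≡ S′ → (∀ x → Region L R′ x → Region L S′ x) → R ⊑ S
  ⊆⇒⊑ eq eq′ R⊆S x Cx Sx = proj₂ (Region⇒ eq′ (R⊆S x (⇒Region eq Cx Sx)))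

  rep : Fin m → List Hyp
  rep a = proj₁ (hyps (Pr.repValid a))

  rep-pairs : ∀ a → pairs (rep a) ≡ Pr.rep a
  rep-pairs a = proj₂ (hyps (Pr.repValid a))

  pairs-valid : ∀ R → All (HEdge L) (pairs R)
  pairs-valid []      = []
  pairs-valid (h ∷ R) = Edge⇒HEdge cov {f₀ = f₀} pl (isEdge h) ∷ pairs-valid R

  flats : FlatPoset arrangement m
  flats = record
    { rep = rep
    ; rep-real = λ a → let x , x∈ = Pr.repNonempty a ; Cx , Sx = Region⇒ (rep-pairs a) x∈ in x , Cx , Sx
    ; rep-antisym = λ {a} {b} i j → Pr.repDistinct a b λ x →
        mk⇔ (⊑⇒⊆ (rep-pairs a) (rep-pairs b) i x) (⊑⇒⊆ (rep-pairs b) (rep-pairs a) j x)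
    ; rep-cover = λ R (x , Cx , Sx) →
        let a , same = Pr.repCover (pairs R) (pairs-valid R) (x , ⇒Region refl Cx Sx) in
        a , ⊆⇒⊑ refl (rep-pairs a) (λ x → to (same x)) , ⊆⇒⊑ (rep-pairs a) refl (λ x → from (same x))
    ; lt = Pr.lt
    ; lt⇒ = λ {b} {a} eq → let b≢a , sub = to (Pr.ltSpec b a) eq in b≢a , ⊆⇒⊑ (rep-pairs a) (rep-pairs b) sub
    ; ⇒lt = λ {b} {a} b≢a i → from (Pr.ltSpec b a) (b≢a , ⊑⇒⊆ (rep-pairs a) (rep-pairs b) i)
    ; bot = Pr.bot
    ; bot-full = ⊆⇒⊑ {[]} refl (rep-pairs Pr.bot) (λ x → from (Pr.botSpec x))
    }

  orient : Point L → Orientation L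
  orient v = Vec.tabulate λ j → Vec.tabulate λ k → does (edge? j k ×-dec (v j <? v k))

  arrow-orient : ∀ v j k → arrow L (orient v) j k ≡ does (edge? j k ×-dec (v j <? v k))
  arrow-orient v j k = trans (cong (λ r → Vec.lookup r k) (Vec.lookup∘tabulate _ j)) (Vec.lookup∘tabulate _ k)

  arrow⇒< : ∀ {v j k} → arrow L (orient v) j k ≡ true → Edge L j k × v j < v k
  arrow⇒< {v} {j} {k} eq = does⇒ (edge? j k ×-dec (v j <? v k)) (trans (sym (arrow-orient v j k)) eq)

  <⇒arrow : ∀ {v j k} → Edge L j k → v j < v k → arrow L (orient v) j k ≡ true
  <⇒arrow {v} {j} {k} e lt = trans (arrow-orient v j k) (dec-true (edge? j k ×-dec (v j <? v k)) (e , lt))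

  ≮⇒arrow : ∀ {v j k} → ¬ (Edge L j k × v j < v k) → arrow L (orient v) j k ≡ false
  ≮⇒arrow {v} {j} {k} ¬p = trans (arrow-orient v j k) (dec-false (edge? j k ×-dec (v j <? v k)) ¬p)

  orient-isOrientation : ∀ {v} → (∀ {j k} → Edge L j k → v j ≢ v k) → IsOrientation L (orient v)
  orient-isOrientation {v} generic j k = exactly-one , λ ¬e → ≮⇒arrow {v} (¬e ∘ proj₁)
    where
    exactly-one : Edge L j k → (arrow L (orient v) j k xor arrow L (orient v) k j) ≡ true
    exactly-one e with <-cmp (v j) (v k)
    ... | tri< lt _ ≯ = cong₂ _xor_ (<⇒arrow {v} e lt) (≮⇒arrow {v} (≯ ∘ proj₂))
    ... | tri≈ _ eq _ = contradiction eq (generic e)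
    ... | tri> ≮ _ gt = cong₂ _xor_ (≮⇒arrow {v} (≮ ∘ proj₂)) (<⇒arrow {v} (Edge-sym e) gt)

  path⇒< : ∀ {v j k} → Path L (orient v) j k → v j < v k
  path⇒< {v} (step a)  = proj₂ (arrow⇒< {v} a)
  path⇒< {v} (a ∷ p) = <-trans (proj₂ (arrow⇒< {v} a)) (path⇒< {v} p)

  -- An orientation puts each edge strictly on one side of its hyperplane, so nothing agrees with
  -- `null`.
  Agrees : Orientation L → Hyp × Sign → Set
  Agrees o (h , null) = ⊥
  Agrees o (h , pos)  = arrow L o (src h) (tgt h) ≡ true
  Agrees o (h , neg)  = arrow L o (tgt h) (src h) ≡ true

  agrees? : ∀ o hc → Dec (Agrees o hc)
  agrees? o (h , null) = no λ ()
  agrees? o (h , pos)  = arrow L o (src h) (tgt h) Bool.≟ true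
  agrees? o (h , neg)  = arrow L o (tgt h) (src h) Bool.≟ true

  Agrees⇒Holds : ∀ {o w} → (∀ j k → arrow L o j k ≡ true → w j < w k) →
    ∀ {hc} → Agrees o hc → Holds (proj₂ hc) (φ (proj₁ hc) w)
  Agrees⇒Holds inc {h , pos} a = <⇒0<gap (inc _ _ a)
  Agrees⇒Holds inc {h , neg} a = >⇒gap<0 (inc _ _ a)

  Holds⇒Agrees : ∀ {v h c} → Strict c → Holds c (φ h v) → Agrees (orient v) (h , c)
  Holds⇒Agrees {v} {h} pos p = <⇒arrow {v} (isEdge h) (0<gap⇒< p)
  Holds⇒Agrees {v} {h} neg p = <⇒arrow {v} (Edge-sym (isEdge h)) (gap<0⇒> p)

  -- A point x of P is moved slightly towards w ∈ P°: the hyperplanes missing x keep their sign,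
  -- and those through x acquire the sign they have at w.
  nudge : ∀ {x w} → InS L x → InO L x → C w → ∃[ v ] (C v ×
    (∀ {h c} → Strict c → Holds c (φ h x) → Holds c (φ h v)) ×
    (∀ {h c} → Strict c → φ h x ≡ 0ℚ → Holds c (φ h w) → Holds c (φ h v)))
  nudge {x} {w} x∈S 0≤x (w∈S , 0<w)
    with ε , 0<ε , near ← signs-open (allFin (length edges)) x w
    -- The bound ½ keeps γ below 1, so the new point lies strictly between x and w and inherits
    -- positive coordinates from w.
    with γ , 0<γ , ≤ε , ≤½ ← within-⊓ 0<ε (positive⁻¹ ℚ.½) =
    line x w γ , (InS-line {x} {w} γ x∈S w∈S , λ j → lin-nonNeg-pos (0≤x j) (0<w j) 0<γ γ<1) ,
    (λ {h} σ p → near γ (≤ε γ (∣p∣≤p 0<γ)) (∈-allFin h) σ p) ,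
    (λ {h} {c} σ x∈h p → subst (Holds c) (sym (φ-lin-null h w γ x∈h)) (scale σ p))
    where
    γ<1 : γ < 1ℚ
    γ<1 = ≤-<-trans (≤-trans (p≤∣p∣ γ) (≤½ γ (∣p∣≤p 0<γ))) ½<1
    scale : ∀ {c q} → Strict c → Holds c q → Holds c (γ * q)
    scale pos p = *-pos 0<γ p
    scale neg p = *-neg 0<γ p

  -- Comparing the counts one integer point at a time

  module Counting (dec : ∀ cs → Dec (Real cs)) (mu : Fin m → ℤ) (isMu : IsMobiusFromBottom L Pr mu)
    (t : ℕ) (1≤t : 1 ℕ.≤ t) where

    open Regions arrangement dec using (regions; isEmpty)
    open Moebius arrangement dec flats (allFin (length edges)) ∈-allFin (hyp-proper cov {f₀ = f₀} pl)
    open Scaled t 1≤t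

    mu≡whitney : ∀ a → mu a ≡ whitney a
    mu≡whitney = moebius-unique mu (proj₁ isMu) (proj₂ isMu)

    point : Vec ℤ d → Point L
    point y = pt (Vec.lookup y)

    IntPt⇒ : ∀ {Q : Point L → Set} {R} y → (∀ {x x′} → (∀ j → x j ≡ x′ j) → Q x → Q x′) → IntPt L Q R t y →
      Q (point y) × Flat L R (point y)
    IntPt⇒ {Q} {R} y Q-cong (x , Qx , (x∈S , x∈R) , eq) =
      Q-cong x≡ Qx , (λ i → trans (lineSum-cong i x≡′) (x∈S i)) , All.map (λ {jk} e → trans (x≡′ _) (trans e (x≡ _))) x∈R
      where
      x≡′ : ∀ j → point y j ≡ x j
      x≡′ = pt-unique eq
      x≡ : ∀ j → x j ≡ point y j
      x≡ j = sym (x≡′ j)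

    ⇒IntPt : ∀ {Q : Point L → Set} {R} y → Q (point y) → Flat L R (point y) → IntPt L Q R t y
    ⇒IntPt y Qy Fy = point y , Qy , Fy , pt-scaled (Vec.lookup y)

    inFlat⇒OnFlats : ∀ a {x} → All (λ h → φ h x ≡ 0ℚ) (rep a) → OnFlats L (Pr.rep a) x
    inFlat⇒OnFlats a {x} all = subst (λ S → OnFlats L S x) (rep-pairs a) (Sat⇒OnFlats (All⇒Sat all))

    OnFlats⇒inFlat : ∀ a {x} → OnFlats L (Pr.rep a) x → All (λ h → φ h x ≡ 0ℚ) (rep a)
    OnFlats⇒inFlat a {x} on = Sat⇒All (OnFlats⇒Sat (subst (λ S → OnFlats L S x) (sym (rep-pairs a)) on))

    -- The list representing the bottom is only known to hold on P°; `Flat-⊑` extends this to all of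
    -- s, boundary points of the orthant included.
    onBot : ∀ {x} → InS L x → OnFlats L (Pr.rep Pr.bot) x
    onBot x∈ = inFlat⇒OnFlats Pr.bot (Sat⇒All
      (Flat-⊑ {[]} (Real-[] (FlatPoset.rep-real flats Pr.bot)) (FlatPoset.bot-full flats) x∈ []))
      where
      Real-[] : ∀ {cs} → Real cs → Real []
      Real-[] (x , Cx , _) = x , Cx , []

    _≟ⱽ_ : DecidableEquality (Vec ℤ d)
    _≟ⱽ_ = Vec.≡-dec ℤ._≟_

    cast : Vec ℕ d → Vec ℤ d
    cast = Vec.map (λ k → ℤ.+ k)

    cast-lookup : ∀ f j → Vec.lookup (cast f) j ≡ ℤ.+ Vec.lookup f j
    cast-lookup f j = Vec.lookup-map j (λ k → ℤ.+ k) f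

    cast-injective : ∀ {f g} → cast f ≡ cast g → f ≡ g
    cast-injective {f} {g} eq = lookup-ext λ j → ℤ.+-injective
      (trans (sym (cast-lookup f j)) (trans (cong (λ v → Vec.lookup v j) eq) (cast-lookup g j)))

    -- Points of t(Q ∩ ū) for all flats u are listed among those for u = P°.
    module Enumerated {Q : Point L → Set} (Q-cong : ∀ {x x′ : Point L} → (∀ j → x j ≡ x′ j) → Q x → Q x′)
      (e : Fin m → ℕ) (count : ∀ a → HasCount (IntPt L Q (Pr.rep a) t) (e a)) where

      ys : List (Vec ℤ d)
      ys = proj₁ (count Pr.bot)

      ys-unique : Unique ys
      ys-unique = proj₁ (proj₂ (count Pr.bot))

      ∈ys⇒ : ∀ {y} → y ∈ ys → Q (point y) × InS L (point y)
      ∈ys⇒ {y} i with Qy , y∈ , _ ← IntPt⇒ {Q} y Q-cong (to (proj₁ (proj₂ (proj₂ (count Pr.bot))) y) i) = Qy , y∈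

      ⇒∈ys : ∀ {y} → Q (point y) → InS L (point y) → y ∈ ys
      ⇒∈ys {y} Qy y∈ = from (proj₁ (proj₂ (proj₂ (count Pr.bot))) y) (⇒IntPt {Q} y Qy (y∈ , onBot y∈))

      e≡sum : ∀ a → ℤ.+ e a ≡ sumL (λ y → ⟦ inFlat? (point y) (rep a) ⟧) ys
      e≡sum a with xs , unique , spec , size ← count a =
        trans (cong (λ k → ℤ.+ k) (sym size)) (trans (length-by-fibres _≟ⱽ_ id ys-unique xs xs⊆ys) (sumL-cong fibre-size))
        where
        xs⊆ys : ∀ {y} → y ∈ xs → y ∈ ys
        xs⊆ys {y} i with Qy , y∈ , _ ← IntPt⇒ {Q} y Q-cong (to (spec y) i) = ⇒∈ys Qy y∈
        fibre-size : ∀ {y} → y ∈ ys → ℤ.+ length (filter (λ z → z ≟ⱽ y) xs) ≡ ⟦ inFlat? (point y) (rep a) ⟧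
        fibre-size {y} i = length-subsingleton (λ z → z ≟ⱽ y) (inFlat? (point y) (rep a)) unique
          (λ _ _ p q → trans p (sym q))
          (λ all → y , from (spec y) (⇒IntPt {Q} y (proj₁ (∈ys⇒ i)) (proj₂ (∈ys⇒ i) , inFlat⇒OnFlats a all)) , refl)
          (λ { j refl → OnFlats⇒inFlat a (proj₂ (proj₂ (IntPt⇒ {Q} y Q-cong (to (spec y) j)))) })

      sum-e : ∀ c → sumℤ (λ a → c a ℤ.* ℤ.+ e a) ≡ sumL (λ y → sumℤ (λ a → ⟦ inFlat? (point y) (rep a) ⟧ ℤ.* c a)) ys
      sum-e c = trans (sumℤ-cong λ a → cong (λ z → c a ℤ.* z) (e≡sum a))
                      (sumL-sumℤ c (λ a y → ⟦ inFlat? (point y) (rep a) ⟧) ys)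

    point-cast : ∀ f j → point (cast f) j ≡ pt (λ k → ℤ.+ Vec.lookup f k) j
    point-cast f j = cong (λ z → c * ι z) (cast-lookup f j)

    InS-cast : ∀ {f} → NonnegLabelling L t f → InS L (point (cast f))
    InS-cast {f} sums i = trans (lineSum-cong i (point-cast f)) (InS-pt sums i)

    cast-InS : ∀ {f} → InS L (point (cast f)) → NonnegLabelling L t f
    cast-InS {f} f∈ = pt-InS λ i → trans (sym (lineSum-cong i (point-cast f))) (f∈ i)

    InO-cast : ∀ f → InO L (point (cast f))
    InO-cast f j = pt-nonNeg {Vec.lookup (cast f)} {j} (subst (ℤ.0ℤ ℤ.≤_) (sym (cast-lookup f j)) (ℤ.+≤+ ℕ.z≤n))

    InO°-cast : ∀ {f} → (∀ j → 0 ℕ.< Vec.lookup f j) → InO° L (point (cast f))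
    InO°-cast {f} 0<f j = pt-pos {Vec.lookup (cast f)} {j} (subst (ℤ.0ℤ ℤ.<_) (sym (cast-lookup f j)) (ℤ.+<+ (0<f j)))

    cast-pos : ∀ {f} → InO° L (point (cast f)) → ∀ j → 0 ℕ.< Vec.lookup f j
    cast-pos {f} 0<f j = ℤ.drop‿+<+ (subst (ℤ.0ℤ ℤ.<_) (cast-lookup f j) (pt-pos⁻¹ {Vec.lookup (cast f)} {j} (0<f j)))

    cast-equal : ∀ {f j k} → point (cast f) j ≡ point (cast f) k → Vec.lookup f j ≡ Vec.lookup f k
    cast-equal {f} {j} {k} eq = ℤ.+-injective
      (trans (sym (cast-lookup f j)) (trans (pt-injective {Vec.lookup (cast f)} eq) (cast-lookup f k)))

    equal-cast : ∀ {f j k} → Vec.lookup f j ≡ Vec.lookup f k → point (cast f) j ≡ point (cast f) k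
    equal-cast {f} {j} {k} eq = trans (point-cast f j)
      (trans (cong (λ z → c * ι (ℤ.+ z)) eq) (sym (point-cast f k)))

    <-cast : ∀ {f j k} → Vec.lookup f j ℕ.< Vec.lookup f k → point (cast f) j < point (cast f) k
    <-cast {f} {j} {k} lt = subst₂ _<_ (sym (point-cast f j)) (sym (point-cast f k))
      (pt-mono {λ k → ℤ.+ Vec.lookup f k} {j} {k} (ℤ.+<+ lt))

    nonNeg⇒cast : ∀ {y} → InO L (point y) → ∃[ f ] (cast f ≡ y)
    nonNeg⇒cast {y} 0≤y = Vec.map ℤ.∣_∣ y , lookup-ext λ j → trans (cast-lookup (Vec.map ℤ.∣_∣ y) j)
      (trans (cong (λ k → ℤ.+ k) (Vec.lookup-map j ℤ.∣_∣ y))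
        (ℤ.0≤i⇒+∣i∣≡i (pt-nonNeg⁻¹ {Vec.lookup y} {j} (0≤y j))))

    isEmpty-filter : ∀ {T : Hyp → Set} (T? : ∀ h → Dec (T h)) B → isEmpty (filter T? B) ≡ ⟦ All.all? (λ h → ¬? (T? h)) B ⟧
    isEmpty-filter T? [] = refl
    isEmpty-filter T? (h ∷ B) with T? h
    ... | yes _ = refl
    ... | no ¬t = trans (isEmpty-filter T? B) (⟦⟧-cong (All.all? (λ h → ¬? (T? h)) B) _ (λ all → ¬t ∷ all) All.tail)

    -- Both sides are sums over the positive integer points y with y/t in s. At each y the left side
    -- is 1 or 0 according as y is latin, and so is the sum of μ over the flats through y/t.
    latin-count : ∀ (N : ℕ) (e : Fin m → ℕ) → HasCount (PosLatin L t) N →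
      (∀ a → HasCount (IntPt L (InO° L) (Pr.rep a) t) (e a)) →
      ℤ.+ N ≡ sumℤ (λ a → mu a ℤ.* ℤ.+ e a)
    latin-count N e (zs , unique , spec , size) count = begin
      ℤ.+ N                                             ≡⟨ cong (λ k → ℤ.+ k) (sym size) ⟩
      ℤ.+ length zs                                     ≡⟨ length-by-fibres _≟ⱽ_ cast ys-unique zs zs⊆ys ⟩
      sumL (λ y → ℤ.+ length (fibre _≟ⱽ_ cast zs y)) ys ≡⟨ sumL-cong fibre-size ⟩
      sumL (λ y → sumℤ (λ a → ⟦ inFlat? (point y) (rep a) ⟧ ℤ.* whitney a)) ys ≡⟨ sym (sum-e whitney) ⟩
      sumℤ (λ a → whitney a ℤ.* ℤ.+ e a)
        ≡⟨ sumℤ-cong (λ a → cong (λ z → z ℤ.* ℤ.+ e a) (sym (mu≡whitney a))) ⟩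
      sumℤ (λ a → mu a ℤ.* ℤ.+ e a)                     ∎
      where
      open ≡-Reasoning
      open Enumerated {InO° L} (λ eq 0<x j → subst (0ℚ <_) (eq j) (0<x j)) e count
      zs⊆ys : ∀ {f} → f ∈ zs → cast f ∈ ys
      zs⊆ys {f} i = ⇒∈ys (InO°-cast {f} (proj₁ (to (spec f) i))) (InS-cast {f} (proj₂ (proj₂ (to (spec f) i))))
      Generic : Vec ℤ d → Set
      Generic y = All (λ h → ¬ φ h (point y) ≡ 0ℚ) (allFin (length edges))
      generic⇒latin : ∀ {f} → Generic (cast f) → Latin L (Vec.lookup f)
      generic⇒latin {f} gen j k e f≡ with h , eq ← hyp e =
        All.lookup gen (∈-allFin h) (≡⇒gap≡0 {h} {point (cast f)}
          (subst (λ jk → point (cast f) (proj₁ jk) ≡ point (cast f) (proj₂ jk))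
          (sym eq) (equal-cast {f} f≡)))
      latin⇒generic : ∀ {f} → Latin L (Vec.lookup f) → Generic (cast f)
      latin⇒generic {f} lat = All.universal (λ h eq → lat (src h) (tgt h) (isEdge h)
        (cast-equal {f} {src h} {tgt h} (gap≡0⇒≡ {h} {point (cast f)} eq))) (allFin (length edges))
      fibre-size : ∀ {y} → y ∈ ys → ℤ.+ length (fibre _≟ⱽ_ cast zs y) ≡
                   sumℤ (λ a → ⟦ inFlat? (point y) (rep a) ⟧ ℤ.* whitney a)
      fibre-size {y} i = go (nonNeg⇒cast {y} (λ j → <⇒≤ (0<y j)))
        where
        0<y : InO° L (point y)
        0<y = proj₁ (∈ys⇒ i)
        y∈S : InS L (point y)
        y∈S = proj₂ (∈ys⇒ i)
        go : ∃[ f ] (cast f ≡ y) → _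
        go (f , eq) = trans
          (length-subsingleton (λ z → cast z ≟ⱽ y) (All.all? (λ h → ¬? (lies? (point y) h)) (allFin (length edges))) unique
            (λ _ _ p q → cast-injective (trans p (sym q)))
            (λ gen → f , from (spec f) (cast-pos {f} (subst (λ y → InO° L (point y)) (sym eq) 0<y) ,
                       generic⇒latin {f} (subst Generic (sym eq) gen) ,
                       cast-InS {f} (subst (λ y → InS L (point y)) (sym eq) y∈S)) , eq)
            (λ {g} j eq → subst Generic eq (latin⇒generic {g} (proj₁ (proj₂ (to (spec g) j))))))
          (trans (sym (isEmpty-filter (lies? (point y)) (allFin (length edges))))
                 (sym (sum-whitney-point (point y) (y∈S , 0<y))))

    module Fibre {zs : List (Vec ℕ d × Orientation L)} (unique : Unique zs) (spec : ∀ z → (z ∈ zs) ⇔ LaPair L t z)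
      {f : Vec ℕ d} (x∈S : InS L (point (cast f))) where

      x : Point L
      x = point (cast f)

      record Over (cs : List (Hyp × Sign)) (z : Vec ℕ d × Orientation L) : Set where
        constructor over
        field
          label  : cast (proj₁ z) ≡ cast f
          agrees : All (Agrees (proj₂ z)) cs

      over? : ∀ cs z → Dec (Over cs z)
      over? cs z = map′ (λ (p , ag) → over p ag) (λ (over p ag) → p , ag)
        ((cast (proj₁ z) ≟ⱽ cast f) ×-dec All.all? (agrees? (proj₂ z)) cs)

      exactly-one : ∀ {z} → z ∈ zs → ∀ {j k} → Edge L j k →
        (arrow L (proj₂ z) j k xor arrow L (proj₂ z) k j) ≡ true
      exactly-one {z} i {j} {k} = proj₁ (proj₁ (proj₂ (to (spec z) i)) j k)

      no-edge : ∀ {z} → z ∈ zs → ∀ {j k} → ¬ Edge L j k → arrow L (proj₂ z) j k ≡ false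
      no-edge {z} i {j} {k} = proj₂ (proj₁ (proj₂ (to (spec z) i)) j k)

      compatible : ∀ {z} → z ∈ zs → ∀ {j k} → arrow L (proj₂ z) j k ≡ true →
        Vec.lookup (proj₁ z) j ℕ.≤ Vec.lookup (proj₁ z) k
      compatible {z} i {j} {k} = proj₁ (proj₂ (proj₂ (proj₂ (to (spec z) i)))) j k

      Complete : List (Hyp × Sign) → Set
      Complete cs = ∀ h → φ h x ≡ 0ℚ → ∃[ c ] ((h , c) ∈ cs)

      -- If two orientations compatible with the same labelling disagree on an edge, its ends have
      -- equal labels. Then its hyperplane passes through x, so `cs` prescribes its direction and
      -- both orientations obey it.
      arrow-determined : ∀ {cs} → Complete cs → ∀ {g o o′} → (g , o) ∈ zs → (g , o′) ∈ zs → cast g ≡ cast f →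
        All (Agrees o) cs → All (Agrees o′) cs → ∀ {j k} → arrow L o j k ≡ true → arrow L o′ j k ≡ true
      arrow-determined {cs} complete {g} {o} {o′} i i′ g≡f ag ag′ {j} {k} a with edge? j k
      ... | no ¬e with () ← trans (sym a) (no-edge i ¬e)
      ... | yes e with arrow L o′ j k in a′
      ...   | true = refl
      ...   | false = contradiction (hyp e) impossible
        where
        a″ : arrow L o′ k j ≡ true
        a″ = xor-falseˡ (exactly-one i′ e) a′
        x∈jk : x j ≡ x k
        x∈jk = equal-cast {f} (subst (λ g → Vec.lookup g j ≡ Vec.lookup g k) (cast-injective g≡f)
          (ℕ.≤-antisym (compatible i a) (compatible i′ a″)))
        clash : ∀ {h c} → List.lookup edges h ≡ (j , k) → Agrees o (h , c) → Agrees o′ (h , c) → ⊥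
        clash {c = pos} eq p p′
          with () ← trans (sym a′) (subst (λ jk → arrow L o′ (proj₁ jk) (proj₂ jk) ≡ true) eq p′)
        clash {c = neg} eq p p′
          with () ← trans (sym (xor-trueˡ (exactly-one i e) a)) (subst (λ jk → arrow L o (proj₂ jk) (proj₁ jk) ≡ true) eq p)
        impossible : ¬ (∃[ h ] (List.lookup edges h ≡ (j , k)))
        impossible (h , eq) with c , i ← complete h (≡⇒gap≡0 {h} {x}
            (subst (λ jk → x (proj₁ jk) ≡ x (proj₂ jk)) (sym eq) x∈jk)) =
          clash {h} {c} eq (All.lookup ag i) (All.lookup ag′ i)

      Over-unique : ∀ {cs} → Complete cs → ∀ {z z′} → z ∈ zs → z′ ∈ zs → Over cs z → Over cs z′ → z ≡ z′
      Over-unique complete {g , o} {g′ , o′} i i′ (over p ag) (over p′ ag′)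
        with refl ← cast-injective {g} {g′} (trans p (sym p′)) = cong (g ,_) (lookup-ext λ j → lookup-ext λ k →
          bool-ext (arrow-determined complete i i′ p ag ag′) (arrow-determined complete i′ i p ag′ ag))

      -- Nudging x towards w gives a point v on no hyperplane: those missing x keep their sign, and
      -- those through x all occur in `cs`, whose strict signs hold at w. The orientation by
      -- increasing values of v then follows f where labels differ and `cs` where they tie.
      Real⇒Over : ∀ {cs} → All (λ hc → Strict (proj₂ hc) × φ (proj₁ hc) x ≡ 0ℚ) cs → Complete cs →
        Real cs → ∃[ z ] (z ∈ zs × Over cs z)
      Real⇒Over {cs} strict complete (w , Cw , Sw) = finish (nudge {x} {w} x∈S (InO-cast f) Cw)
        where
        finish : ∃[ v ] (C v × (∀ {h c} → Strict c → Holds c (φ h x) → Holds c (φ h v)) ×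
          (∀ {h c} → Strict c → φ h x ≡ 0ℚ → Holds c (φ h w) → Holds c (φ h v))) → ∃[ z ] (z ∈ zs × Over cs z)
        finish (v , Cv , keep , acquire) =
          (f , orient v) , from (spec (f , orient v))
            (cast-InS {f} x∈S , orient-isOrientation {v} generic-edge , (λ j p → <-irrefl refl (path⇒< {v} p)) ,
             compat , v , C⇒InP° Cv , λ j k a → proj₂ (arrow⇒< {v} a)) ,
          over refl (All.tabulate (λ { {h , c} i → Holds⇒Agrees {v} {h} {c} (proj₁ (All.lookup strict i))
                   (acquire {h} {c} (proj₁ (All.lookup strict i)) (proj₂ (All.lookup strict i)) (All.lookup Sw i)) }))
          where
          nonzero : ∀ {c q} → Strict c → Holds c q → q ≢ 0ℚ
          nonzero pos 0<q eq = <⇒≢ 0<q (sym eq)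
          nonzero neg q<0 eq = <⇒≢ q<0 eq
          generic : ∀ h → φ h v ≢ 0ℚ
          generic h with <-cmp (φ h x) 0ℚ
          ... | tri< x<0 _ _ = nonzero neg (keep {h} {neg} neg x<0)
          ... | tri> _ _ 0<x = nonzero pos (keep {h} {pos} pos 0<x)
          ... | tri≈ _ x≡0 _ with c , i ← complete h x≡0 =
            nonzero (proj₁ (All.lookup strict i)) (acquire {h} {c} (proj₁ (All.lookup strict i)) x≡0 (All.lookup Sw i))
          generic-edge : ∀ {j k} → Edge L j k → v j ≢ v k
          generic-edge e eq with h , refl ← hyp e = generic h (≡⇒gap≡0 {h} {v} eq)
          compat : Compatible L (orient v) (Vec.lookup f)
          -- An arrow against a strict inequality of f would reverse a sign that the nudge
          -- preserves.
          compat j k a = ℕ.≮⇒≥ λ fk<fj → increasing (hyp (proj₁ (arrow⇒< {v} a))) fk<fj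
            where
            increasing : ∃[ h ] (List.lookup edges h ≡ (j , k)) → ¬ (Vec.lookup f k ℕ.< Vec.lookup f j)
            increasing (h , refl) lt = <-asym (proj₂ (arrow⇒< {v} a))
              (gap<0⇒> {h} {v} (keep {h} {neg} neg (>⇒gap<0 {h} {x} (<-cast {f} lt))))

      Over⇒Real : ∀ {cs z} → z ∈ zs → Over cs z → Real cs
      Over⇒Real {cs} {z} i (over _ ag) with w , w∈ , inc ← proj₂ (proj₂ (proj₂ (proj₂ (to (spec z) i)))) =
        w , InP°⇒C cov {f₀ = f₀} pl w∈ , All.map (λ {hc} → Agrees⇒Holds {proj₂ z} {w} inc {hc}) ag

      -- Follows the recursion of `regions`: the pairs are split by the direction of the edge of
      -- `h`. Once `B` is used up, `cs` signs every hyperplane through x, so at most one pair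
      -- remains, and it exists exactly if `cs` is realizable.
      count-over : ∀ B cs → All (λ h → φ h x ≡ 0ℚ) B → All (λ hc → Strict (proj₂ hc) × φ (proj₁ hc) x ≡ 0ℚ) cs →
        (∀ h → φ h x ≡ 0ℚ → h ∈ B ⊎ (∃[ c ] ((h , c) ∈ cs))) →
        ℤ.+ length (filter (over? cs) zs) ≡ regions cs B
      count-over [] cs _ strict cover = length-subsingleton (over? cs) (dec cs) unique
        (Over-unique complete) (Real⇒Over strict complete) Over⇒Real
        where
        complete : Complete cs
        complete h eq with cover h eq
        ... | inj₂ found = found
      count-over (h ∷ B) cs (x∈h ∷ x∈B) strict cover = trans
        (length-split (over? cs) (over? ((h , pos) ∷ cs)) (over? ((h , neg) ∷ cs)) zs split
          (λ { (over p (_ ∷ ag)) → over p ag }) (λ { (over p (_ ∷ ag)) → over p ag }) disjoint)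
        (cong₂ ℤ._+_ (count-over B ((h , pos) ∷ cs) x∈B ((pos , x∈h) ∷ strict) (cover′ pos))
                     (count-over B ((h , neg) ∷ cs) x∈B ((neg , x∈h) ∷ strict) (cover′ neg)))
        where
        split : ∀ {z} → z ∈ zs → Over cs z → Over ((h , pos) ∷ cs) z ⊎ Over ((h , neg) ∷ cs) z
        split {g , o} i (over p ag) with arrow L o (src h) (tgt h) in a
        ... | true  = inj₁ (over p (a ∷ ag))
        ... | false = inj₂ (over p (xor-falseˡ (exactly-one i (isEdge h)) a ∷ ag))
        disjoint : ∀ {z} → z ∈ zs → Over ((h , pos) ∷ cs) z → ¬ Over ((h , neg) ∷ cs) z
        disjoint i (over _ (a ∷ _)) (over _ (a′ ∷ _)) with () ← trans (sym a′) (xor-trueˡ (exactly-one i (isEdge h)) a)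
        cover′ : ∀ s h′ → φ h′ x ≡ 0ℚ → h′ ∈ B ⊎ (∃[ c ] ((h′ , c) ∈ ((h , s) ∷ cs)))
        cover′ s h′ eq with cover h′ eq
        ... | inj₁ (here refl)   = inj₂ (s , here refl)
        ... | inj₁ (there i)     = inj₁ i
        ... | inj₂ (c , i)       = inj₂ (c , there i)

      fibre-regions : ℤ.+ length (fibre _≟ⱽ_ (λ z → cast (proj₁ z)) zs (cast f)) ≡
        regions [] (filter (lies? x) (allFin (length edges)))
      fibre-regions = trans
        (cong (λ zs → ℤ.+ length zs)
          (List.filter-≐ (λ z → cast (proj₁ z) ≟ⱽ cast f) (over? []) ((λ p → over p []) , Over.label) zs))
        (count-over _ [] (All.all-filter (lies? x) (allFin (length edges))) []
          λ h eq → inj₁ (∈-filter⁺ (lies? x) (∈-allFin h) eq))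

    -- Over each nonnegative integer point y with y/t in s, the orientations are the regions of P°
    -- cut by the hyperplanes through y/t, and `sum-weight` evaluates their number as the sum of |μ|
    -- over the flats through y/t.
    pair-count : ∀ (N : ℕ) (e : Fin m → ℕ) → HasCount (LaPair L t) N →
      (∀ a → HasCount (IntPt L (InO L) (Pr.rep a) t) (e a)) →
      ℤ.+ N ≡ sumℤ (λ a → ℤ.+ ℤ.∣ mu a ∣ ℤ.* ℤ.+ e a)
    pair-count N e (zs , unique , spec , size) count = begin
      ℤ.+ N                                             ≡⟨ cong (λ k → ℤ.+ k) (sym size) ⟩
      ℤ.+ length zs                                     ≡⟨ length-by-fibres _≟ⱽ_ (λ z → cast (proj₁ z)) ys-unique zs zs⊆ys ⟩
      sumL (λ y → ℤ.+ length (fibre _≟ⱽ_ (λ z → cast (proj₁ z)) zs y)) ys ≡⟨ sumL-cong fibre-size ⟩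
      sumL (λ y → sumℤ (λ a → ⟦ inFlat? (point y) (rep a) ⟧ ℤ.* weight a [] (allFin (length edges)))) ys
        ≡⟨ sym (sum-e (λ a → weight a [] (allFin (length edges)))) ⟩
      sumℤ (λ a → weight a [] (allFin (length edges)) ℤ.* ℤ.+ e a)
        ≡⟨ sumℤ-cong (λ a → cong (λ z → z ℤ.* ℤ.+ e a) (∣mu∣ a)) ⟩
      sumℤ (λ a → ℤ.+ ℤ.∣ mu a ∣ ℤ.* ℤ.+ e a)           ∎
      where
      open ≡-Reasoning
      open Enumerated {InO L} (λ eq 0≤x j → subst (0ℚ ≤_) (eq j) (0≤x j)) e count
      ∣mu∣ : ∀ a → weight a [] (allFin (length edges)) ≡ ℤ.+ ℤ.∣ mu a ∣
      ∣mu∣ a = trans (sym (∣whitney∣ a)) (cong (λ z → ℤ.+ ℤ.∣ z ∣) (sym (mu≡whitney a)))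
      zs⊆ys : ∀ {z} → z ∈ zs → cast (proj₁ z) ∈ ys
      zs⊆ys {f , o} i = ⇒∈ys (InO-cast f) (InS-cast {f} (proj₁ (to (spec (f , o)) i)))
      fibre-size : ∀ {y} → y ∈ ys → ℤ.+ length (fibre _≟ⱽ_ (λ z → cast (proj₁ z)) zs y) ≡
                   sumℤ (λ a → ⟦ inFlat? (point y) (rep a) ⟧ ℤ.* weight a [] (allFin (length edges)))
      fibre-size {y} i = trans (go (nonNeg⇒cast {y} (proj₁ (∈ys⇒ i))) (proj₂ (∈ys⇒ i)))
                               (sym (sum-weight (point y) (proj₂ (∈ys⇒ i))))
        where
        go : ∃[ f ] (cast f ≡ y) → InS L (point y) →
          ℤ.+ length (fibre _≟ⱽ_ (λ z → cast (proj₁ z)) zs y) ≡ regions [] (filter (lies? (point y)) (allFin (length edges)))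
        go (f , refl) y∈S = Fibre.fibre-regions unique spec {f} y∈S

open import Data.Nat using (_≤_)
open import Data.Integer using (+_; _*_; ∣_∣)

theorem4p8 : (d n : ℕ) (L : Fin n → Subset d) →
    CoveringClutter d n L → Uniform L →
    (∃[ t₀ ] ∃[ f₀ ] PosLatin L t₀ f₀) →
    (m : ℕ) (Pr : Presentation L m) (mu : Fin m → ℤ) → IsMobiusFromBottom L Pr mu →
    (t : ℕ) → 1 ≤ t →
    (∀ (N : ℕ) (e : Fin m → ℕ) →
    HasCount (PosLatin L t) N →
    (∀ a → HasCount (IntPt L (InO° L) (Presentation.rep Pr a) t) (e a)) →
    + N ≡ sumℤ (λ a → mu a * + e a))
    × (∀ (N : ℕ) (e : Fin m → ℕ) →
    HasCount (LaPair L t) N →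
    (∀ a → HasCount (IntPt L (InO L) (Presentation.rep Pr a) t) (e a)) →
    + N ≡ sumℤ (λ a → + ∣ mu a ∣ * + e a))
theorem4p8 d n L cov _ (t₀ , f₀ , pl) m Pr mu isMu t 1≤t =
  (λ N e hN he → stable λ dec → Counting.latin-count dec mu isMu t 1≤t N e hN he) ,
  (λ N e hN he → stable λ dec → Counting.pair-count dec mu isMu t 1≤t N e hN he)
  where
  open LatinLabellings L cov {f₀ = f₀} pl Pr
  open Arrangement (Geometry.arrangement L) using (Real)
  stable : ∀ {x y : ℤ} → ((∀ cs → Dec (Real cs)) → x ≡ y) → x ≡ y
  stable {x} {y} f = decidable-stable (x ℤ.≟ y) λ x≢y → ¬¬-dec-Real (x≢y ∘ f)
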